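{- For all $n>0$, there exists a $\Sigma_{n+1}$-sentence $\varphi$ of HyperLTL that is not equivalent to any $\Sigma_n$-sentence, and such that for all $T\subseteq (2^{\mathrm{AP}})^\omega$, if $T\models\varphi$ then $T$ contains finitely many traces and $T\subseteq (2^{\mathrm{AP}})^*\emptyset^\omega$.
   Context: Fix a finite set $\mathrm{AP}$ of atomic propositions. A trace over $\mathrm{AP}$ is a map $t\colon \mathbb{N} \to 2^{\mathrm{AP}}$; $(2^{\mathrm{AP}})^\omega$ is the set of all traces, and $(2^{\mathrm{AP}})^*\emptyset^\omega$ is the set of traces that are eventually constantly $\emptyset$. HyperLTL formulas are given by $\varphi ::= \exists \pi.\ \varphi \mid \forall \pi.\ \varphi \mid \psi$ and $\psi ::= a_\pi \mid \neg\psi \mid \psi\vee\psi \mid \mathbf{X}\psi \mid \psi\,\mathbf{U}\,\psi$, where $a$ ranges over $\mathrm{AP}$ and $\pi$ ranges over a fixed countable set $\mathcal{V}$ of trace variables. A sentence is a formula without free variables. HyperLTL sentences are required to be in prenex normal form, but they are closed under Boolean combinations, as such combinations can be transformed into prenex normal form. A trace assignment is a partial map $\Pi\colon \mathcal{V} \to (2^{\mathrm{AP}})^\omega$; $\Pi_\emptyset$ is the one with empty domain; $\Pi[\pi\to t]$ is $\Pi$ updated to map $\pi$ to $t$; $\Pi[j,\infty)$ maps every $\pi$ in the domain of $\Pi$ to the suffix $\Pi(\pi)(j)\Pi(\pi)(j+1)\cdots$. For a set $T$ of traces: $(T,\Pi)\models a_\pi$ iff $a\in\Pi(\pi)(0)$;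 $(T,\Pi)\models\neg\psi$ iff $(T,\Pi)\not\models\psi$; $(T,\Pi)\models\psi_1\vee\psi_2$ iff $(T,\Pi)\models\psi_1$ or $(T,\Pi)\models\psi_2$; $(T,\Pi)\models\mathbf{X}\psi$ iff $(T,\Pi[1,\infty))\models\psi$; $(T,\Pi)\models\psi_1\mathbf{U}\psi_2$ iff there is $j\ge 0$ with $(T,\Pi[j,\infty))\models\psi_2$ and $(T,\Pi[j',\infty))\models\psi_1$ for all $0\le j'<j$; $(T,\Pi)\models\exists\pi.\ \varphi$ (resp. $\forall\pi.\ \varphi$) iff for some (resp. all) $t\in T$, $(T,\Pi[\pi\to t])\models\varphi$. For a sentence $\varphi$, $T\models\varphi$ means $(T,\Pi_\emptyset)\models\varphi$. Two sentences $\varphi,\varphi'$ are equivalent if $T\models\varphi$ iff $T\models\varphi'$ for every set $T$ of traces. Quantifier alternation: a formula is a $\Sigma_0$- or $\Pi_0$-formula if it is quantifier-free. It is a $\Sigma_n$-formula if it has the form $\exists\pi_1\cdots\exists\pi_k.\ \psi$ with $\psi$ a $\Pi_{n-1}$-formula, and a $\Pi_n$-formula if it has the form $\forall\pi_1\cdots\forall\pi_k.\ \psi$ with $\psi$ a $\Sigma_{n-1}$-formula; $k=0$ is allowed (blocks of quantifiers may be empty). A $\Sigma_n$-sentence is a $\Sigma_n$-formula that is a sentence. -}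

module Defs where

open import Data.Bool.Base using (if_then_else_)
open import Data.Fin.Base using (Fin)
open import Data.Fin.Subset using (Subset; ⊥; _∈_)
open import Data.List.Base using (List; foldr)
import Data.List.Relation.Unary.Any as ListAny
open import Data.Maybe.Base as Maybe using (Maybe; just; nothing)
import Data.Maybe.Relation.Unary.Any as MaybeAny
open import Data.Nat.Base using (ℕ; zero; suc; _+_; _≤_; _<_)
open import Data.Nat.Properties using (_≟_)
open import Data.Product.Base using (_×_; ∃-syntax)
open import Data.Sum.Base using (_⊎_)
open import Function.Bundles using (_⇔_)
open import Level using (0ℓ)
open import Relation.Binary.Definitions using (_Respects_)
open import Relation.Binary.PropositionalEquality using (_≡_; _≢_; _≗_)
open import Relation.Nullary using (¬_; does)
open import Relation.Unary using (Pred)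

-- Throughout, the set AP of atomic propositions is Fin k.
variable
  k : ℕ

Trace : ℕ → Set
Trace k = ℕ → Subset k

-- Traces are compared pointwise (there is no function extensionality), so a
-- set of traces is a predicate that respects pointwise equality.
record TraceSet (k : ℕ) : Set₁ where
  field
    Member   : Pred (Trace k) 0ℓ
    respects : Member Respects _≗_

open TraceSet public

infix 4 _∈ᵀ_

_∈ᵀ_ : Trace k → TraceSet k → Set
t ∈ᵀ T = Member T t

-- Only a covering list is required, since membership in T need not be
-- decidable; classically this is equivalent to T being finite.
Finite : TraceSet k → Set
Finite {k} T = ∃[ ts ] (∀ (t : Trace k) → t ∈ᵀ T → ListAny.Any (t ≗_) ts)

-- Membership in (2^AP)* ∅^ω.
EventuallyEmpty : Trace k → Set
EventuallyEmpty t = ∃[ i ] (∀ j → i ≤ j → t j ≡ ⊥)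

Var : Set
Var = ℕ

infix  9 _at_
infixr 8 ¬′_ X_
infixr 7 _U_
infixr 6 _∨′_

data Matrix (k : ℕ) : Set where
  _at_ : Fin k → Var → Matrix k
  ¬′_  : Matrix k → Matrix k
  _∨′_ : Matrix k → Matrix k → Matrix k
  X_   : Matrix k → Matrix k
  _U_  : Matrix k → Matrix k → Matrix k

data Formula (k : ℕ) : Set where
  matrix : Matrix k → Formula k
  ∃′     : Var → Formula k → Formula k
  ∀′     : Var → Formula k → Formula k

OccursIn : Var → Matrix k → Set
OccursIn π (a at π′)  = π ≡ π′
OccursIn π (¬′ ψ)     = OccursIn π ψ
OccursIn π (ψ₁ ∨′ ψ₂) = OccursIn π ψ₁ ⊎ OccursIn π ψ₂
OccursIn π (X ψ)      = OccursIn π ψ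
OccursIn π (ψ₁ U ψ₂)  = OccursIn π ψ₁ ⊎ OccursIn π ψ₂

FreeIn : Var → Formula k → Set
FreeIn π (matrix ψ) = OccursIn π ψ
FreeIn π (∃′ π′ φ)  = π ≢ π′ × FreeIn π φ
FreeIn π (∀′ π′ φ)  = π ≢ π′ × FreeIn π φ

Sentence : Formula k → Set
Sentence φ = ∀ π → ¬ FreeIn π φ

Assignment : ℕ → Set
Assignment k = Var → Maybe (Trace k)

Π∅ : Assignment k
Π∅ _ = nothing

_[_↦_] : Assignment k → Var → Trace k → Assignment k
(Π [ π ↦ t ]) π′ = if does (π′ ≟ π) then just t else Π π′

suffix : ℕ → Trace k → Trace k
suffix j t i = t (j + i)

_[_,∞⟩ : Assignment k → ℕ → Assignment k
(Π [ j ,∞⟩) π = Maybe.map (suffix j) (Π π)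

infix 4 _⊨ᴹ_ _,_⊨ᶠ_ _⊨_ _≃_

-- The satisfaction of quantifier-free formulas does not depend on T.
-- Atoms on variables outside the domain of Π are false; this never arises
-- when evaluating a sentence.
_⊨ᴹ_ : Assignment k → Matrix k → Set
Π ⊨ᴹ a at π   = MaybeAny.Any (λ t → a ∈ t 0) (Π π)
Π ⊨ᴹ ¬′ ψ     = ¬ (Π ⊨ᴹ ψ)
Π ⊨ᴹ ψ₁ ∨′ ψ₂ = Π ⊨ᴹ ψ₁ ⊎ Π ⊨ᴹ ψ₂
Π ⊨ᴹ X ψ      = Π [ 1 ,∞⟩ ⊨ᴹ ψ
Π ⊨ᴹ ψ₁ U ψ₂  =
  ∃[ j ] (Π [ j ,∞⟩ ⊨ᴹ ψ₂ × (∀ j′ → j′ < j → Π [ j′ ,∞⟩ ⊨ᴹ ψ₁))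

_,_⊨ᶠ_ : TraceSet k → Assignment k → Formula k → Set
T , Π ⊨ᶠ matrix ψ = Π ⊨ᴹ ψ
T , Π ⊨ᶠ ∃′ π φ   = ∃[ t ] (t ∈ᵀ T × T , Π [ π ↦ t ] ⊨ᶠ φ)
T , Π ⊨ᶠ ∀′ π φ   = ∀ t → t ∈ᵀ T → T , Π [ π ↦ t ] ⊨ᶠ φ

_⊨_ : TraceSet k → Formula k → Set
T ⊨ φ = T , Π∅ ⊨ᶠ φ

_≃_ : Formula k → Formula k → Set₁
_≃_ {k} φ φ′ = (T : TraceSet k) → T ⊨ φ ⇔ T ⊨ φ′

-- The list of variables may be empty.
∃* ∀* : List Var → Formula k → Formula k
∃* πs φ = foldr ∃′ φ πs
∀* πs φ = foldr ∀′ φ πs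

mutual
  IsΣ : ℕ → Formula k → Set
  IsΣ zero    φ = ∃[ ψ ] φ ≡ matrix ψ
  IsΣ (suc n) φ = ∃[ πs ] ∃[ χ ] (φ ≡ ∃* πs χ × IsΠ n χ)

  IsΠ : ℕ → Formula k → Set
  IsΠ zero    φ = ∃[ ψ ] φ ≡ matrix ψ
  IsΠ (suc n) φ = ∃[ πs ] ∃[ χ ] (φ ≡ ∀* πs χ × IsΣ n χ)

IsΣSentence : ℕ → Formula k → Set
IsΣSentence n φ = IsΣ n φ × Sentence φ

{-# OPTIONS --safe #-}

-- Fix a budget of m quantifiers and X-depth d. Ordered trees are encoded as sets
-- of traces: each leaf is a trace that marks the start of every subtree
-- containing it, followed by its label. With leaves labelled differently, set
-- A_{j+1} = B_j … B_j and B_{j+1} = B_j … B_j A_j B_j … B_j, with many copies of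
-- B_j. Every Σ_j-formula within the budget that holds for A_j holds for B_j: in
-- the Ehrenfeucht–Fraïssé game, the first block of moves in A_{j+1} leaves many
-- copies of B_j untouched, and when the roles are switched one of them answers
-- the moves in the copy of A_j. This uses that matrices of X-depth d neither
-- distinguish words of the form ∅^p and ∅^q with p, q > d, nor see anything of a
-- leaf inside subtrees that do not contain it. On the other hand, that every child
-- of A_{j+1} is a B_j can be unravelled into an alternation ∀∃∀… of j+1
-- quantifiers, each choosing a leaf below the node reached so far. An outer ∃ picks
-- a trace whose last mark bounds all other traces, which forces finiteness.
module Submission where

open import Data.Bool.Base using (Bool; true; false; if_then_else_)
open import Data.Fin.Base using (zero)
open import Data.Fin.Subset using (Subset; ⊥; ⊤; _∈_)
open import Data.Fin.Subset.Properties using (∉⊥; ∈⊤; _∈?_; Empty-unique)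
open import Data.List.Base
  using (List; []; _∷_; _++_; [_]; replicate; foldr; allFin; map; cartesianProductWith)
open import Data.List.Membership.Propositional using () renaming (_∈_ to _∈ˡ_)
open import Data.List.Membership.Propositional.Properties
  using (∈-cartesianProductWith⁺; ∈-map⁺; ∈-allFin)
open import Data.List.Properties using (++-assoc)
open import Data.List.Relation.Unary.Any as ListAny using (here; there)
open import Data.Maybe.Base using (just; nothing; maybe)
import Data.Maybe.Relation.Unary.Any as MaybeAny
open import Data.Nat.Base
open import Data.Nat.Properties
open import Data.Product.Base using (_×_; _,_; proj₁; proj₂; Σ-syntax; ∃-syntax; map₂)
open import Data.Sum.Base as Sum using (_⊎_; inj₁; inj₂)
open import Data.Vec.Base as Vec using (Vec)
open import Function.Base using (_∘_)
open import Function.Bundles using (_⇔_; mk⇔; Equivalence)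
open import Relation.Binary.Definitions using (tri<; tri≈; tri>)
open import Relation.Binary.PropositionalEquality hiding ([_])
open import Relation.Nullary using (¬_; does; contradiction)
open import Relation.Nullary.Decidable using (dec-true; dec-false; decidable-stable)
open import Defs

open Equivalence using (to; from)

-- Splicing of traces

𝟘 : Trace k
𝟘 _ = ⊥

splice : ℕ → Trace k → Trace k → Trace k
splice zero    u v i       = v i
splice (suc L) u v zero    = u zero
splice (suc L) u v (suc i) = splice L (u ∘ suc) v i

splice-cong : ∀ L {u u′ v v′ : Trace k} → u ≗ u′ → v ≗ v′ → splice L u v ≗ splice L u′ v′
splice-cong zero    p q i       = q i
splice-cong (suc L) p q zero    = p zero
splice-cong (suc L) p q (suc i) = splice-cong L (p ∘ suc) q i

splice-assoc : ∀ a b (u v w : Trace k) →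
  splice (a + b) (splice a u v) w ≗ splice a u (splice b v w)
splice-assoc zero    b u v w i       = refl
splice-assoc (suc a) b u v w zero    = refl
splice-assoc (suc a) b u v w (suc i) = splice-assoc a b (u ∘ suc) v w i

splice-𝟘 : ∀ L → splice {k} L 𝟘 𝟘 ≗ 𝟘
splice-𝟘 zero    i       = refl
splice-𝟘 (suc L) zero    = refl
splice-𝟘 (suc L) (suc i) = splice-𝟘 L i

splice-≥ : ∀ L (u v : Trace k) i → splice L u v (L + i) ≡ v i
splice-≥ zero    u v i = refl
splice-≥ (suc L) u v i = splice-≥ L (u ∘ suc) v i

splice-< : ∀ {L i} (u v : Trace k) → i < L → splice L u v i ≡ u i
splice-< {L = suc L} {zero}  u v _       = refl
splice-< {L = suc L} {suc i} u v (s≤s p) = splice-< (u ∘ suc) v p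

Vanishes : ℕ → Trace k → Set
Vanishes L u = ∀ i → u (L + i) ≡ ⊥

splice-vanishes : ∀ L {u : Trace k} → Vanishes L u → splice L u 𝟘 ≗ u
splice-vanishes zero    p i       = sym (p i)
splice-vanishes (suc L) p zero    = refl
splice-vanishes (suc L) p (suc i) = splice-vanishes L p i

-- Total valuations in place of partial assignments

Valuation : ℕ → Set
Valuation k = Var → Trace k

infix 4 _≗ⱽ_ _≋_

_≗ⱽ_ : Valuation k → Valuation k → Set
ρ ≗ⱽ σ = ∀ π → ρ π ≗ σ π

≗ⱽ-sym : {ρ σ : Valuation k} → ρ ≗ⱽ σ → σ ≗ⱽ ρ
≗ⱽ-sym p π i = sym (p π i)

≗ⱽ-trans : {ρ σ τ : Valuation k} → ρ ≗ⱽ σ → σ ≗ⱽ τ → ρ ≗ⱽ τ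
≗ⱽ-trans p q π i = trans (p π i) (q π i)

𝟘ⱽ : Valuation k
𝟘ⱽ _ = 𝟘

spliceⱽ : ℕ → Valuation k → Valuation k → Valuation k
spliceⱽ L ρ τ π = splice L (ρ π) (τ π)

_[_≔_] : Valuation k → Var → Trace k → Valuation k
(ρ [ x ≔ u ]) π = if does (π ≟ x) then u else ρ π

≔-cong : ∀ {ρ ρ′ : Valuation k} x {u u′} → ρ ≗ⱽ ρ′ → u ≗ u′ → ρ [ x ≔ u ] ≗ⱽ ρ′ [ x ≔ u′ ]
≔-cong x p q π with does (π ≟ x)
... | true  = q
... | false = p π

≔-splice : ∀ L {ρ σ : Valuation k} x {u v} →
  spliceⱽ L (ρ [ x ≔ u ]) (σ [ x ≔ v ]) ≗ⱽ spliceⱽ L ρ σ [ x ≔ splice L u v ]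
≔-splice L x π with does (π ≟ x)
... | true  = λ _ → refl
... | false = λ _ → refl

≔-𝟘 : ∀ x → 𝟘ⱽ {k} [ x ≔ 𝟘 ] ≗ⱽ 𝟘ⱽ
≔-𝟘 x π with does (π ≟ x)
... | true  = λ _ → refl
... | false = λ _ → refl

-- Atoms on undefined variables are false, as they are on the empty trace.
valuation : Assignment k → Valuation k
valuation Π π i = maybe (λ t → t i) ⊥ (Π π)

_≋_ : Assignment k → Assignment k → Set
Π ≋ Π′ = valuation Π ≗ⱽ valuation Π′

⟦_⟧ : Valuation k → Assignment k
⟦ τ ⟧ π = just (τ π)

valuation-suffix : ∀ (Π : Assignment k) j π i → valuation (Π [ j ,∞⟩) π i ≡ valuation Π π (j + i)
valuation-suffix Π j π i with Π π
... | just t  = refl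
... | nothing = refl

≋-suffix : (Π Π′ : Assignment k) → Π ≋ Π′ → ∀ j → Π [ j ,∞⟩ ≋ Π′ [ j ,∞⟩
≋-suffix Π Π′ p j π i =
  trans (valuation-suffix Π j π i) (trans (p π (j + i)) (sym (valuation-suffix Π′ j π i)))

⊨-atom : ∀ (Π : Assignment k) a π → Π ⊨ᴹ (a at π) ⇔ (a ∈ valuation Π π 0)
⊨-atom Π a π with Π π
... | just t  = mk⇔ (λ { (MaybeAny.just p) → p }) MaybeAny.just
... | nothing = mk⇔ (λ ()) (λ p → contradiction p ∉⊥)

⊨-resp-≋ : ∀ ψ {Π Π′ : Assignment k} → Π ≋ Π′ → Π ⊨ᴹ ψ → Π′ ⊨ᴹ ψ
⊨-resp-≋ (a at π) {Π} {Π′} p s =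
  from (⊨-atom Π′ a π) (subst (a ∈_) (p π 0) (to (⊨-atom Π a π) s))
⊨-resp-≋ (¬′ ψ) p s s′ = s (⊨-resp-≋ ψ (≗ⱽ-sym p) s′)
⊨-resp-≋ (ψ ∨′ χ) p = Sum.map (⊨-resp-≋ ψ p) (⊨-resp-≋ χ p)
⊨-resp-≋ (X ψ) {Π} {Π′} p = ⊨-resp-≋ ψ (≋-suffix Π Π′ p 1)
⊨-resp-≋ (ψ U χ) {Π} {Π′} p (j , s , f) =
  j , ⊨-resp-≋ χ (≋-suffix Π Π′ p j) s , λ i i<j → ⊨-resp-≋ ψ (≋-suffix Π Π′ p i) (f i i<j)

-- Equivalence up to X-depth, and stuttering

depth : Matrix k → ℕ
depth (a at π) = 0
depth (¬′ ψ)   = depth ψ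
depth (ψ ∨′ χ) = depth ψ ⊔ depth χ
depth (X ψ)    = suc (depth ψ)
depth (ψ U χ)  = depth ψ ⊔ depth χ

infix 4 _≡[_]_

_≡[_]_ : Valuation k → ℕ → Valuation k → Set
τ ≡[ d ] τ′ = ∀ ψ → depth ψ ≤ d → ⟦ τ ⟧ ⊨ᴹ ψ ⇔ ⟦ τ′ ⟧ ⊨ᴹ ψ

≡[]-sym : ∀ {d} {τ τ′ : Valuation k} → τ ≡[ d ] τ′ → τ′ ≡[ d ] τ
≡[]-sym p ψ le = mk⇔ (from (p ψ le)) (to (p ψ le))

≡[]-trans : ∀ {d} {τ τ′ τ″ : Valuation k} → τ ≡[ d ] τ′ → τ′ ≡[ d ] τ″ → τ ≡[ d ] τ″
≡[]-trans p q ψ le = mk⇔ (to (q ψ le) ∘ to (p ψ le)) (from (p ψ le) ∘ from (q ψ le))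

≗⇒≡[] : ∀ {d} {τ τ′ : Valuation k} → τ ≗ⱽ τ′ → τ ≡[ d ] τ′
≗⇒≡[] p ψ _ = mk⇔ (⊨-resp-≋ ψ p) (⊨-resp-≋ ψ (≗ⱽ-sym p))

-- Until is handled by its unfolding: either it is fulfilled at once, or the same until formula, of
-- the same depth, holds on the tail, where the hypothesis applies to it as a whole.
spliceⱽ-letter : ∀ {d} (ρ : Valuation k) {τ τ′} → τ ≡[ d ] τ′ → ∀ ψ → depth ψ ≤ d →
  ⟦ spliceⱽ 1 ρ τ ⟧ ⊨ᴹ ψ → ⟦ spliceⱽ 1 ρ τ′ ⟧ ⊨ᴹ ψ
spliceⱽ-letter ρ p (a at π) le (MaybeAny.just s) = MaybeAny.just s
spliceⱽ-letter ρ p (¬′ ψ) le s s′ = s (spliceⱽ-letter ρ (≡[]-sym p) ψ le s′)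
spliceⱽ-letter ρ p (ψ ∨′ χ) le =
  Sum.map (spliceⱽ-letter ρ p ψ (m⊔n≤o⇒m≤o _ _ le)) (spliceⱽ-letter ρ p χ (m⊔n≤o⇒n≤o _ _ le))
spliceⱽ-letter ρ p (X ψ) le s = to (p ψ (<⇒≤ le)) s
spliceⱽ-letter ρ p (ψ U χ) le (zero , s , f) =
  zero , spliceⱽ-letter ρ p χ (m⊔n≤o⇒n≤o _ _ le) s , λ _ ()
spliceⱽ-letter ρ p (ψ U χ) le (suc j , s , f)
  with j′ , s′ , f′ ← to (p (ψ U χ) le) (j , s , λ i i<j → f (suc i) (s≤s i<j)) =
  suc j′ , s′ , λ where
    zero    _         → spliceⱽ-letter ρ p ψ (m⊔n≤o⇒m≤o _ _ le) (f 0 z<s)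
    (suc i) (s≤s i<j) → f′ i i<j

spliceⱽ-cong-≡[] : ∀ {d} L (ρ : Valuation k) {τ τ′} → τ ≡[ d ] τ′ →
  spliceⱽ L ρ τ ≡[ d ] spliceⱽ L ρ τ′
spliceⱽ-cong-≡[] zero ρ p = p
spliceⱽ-cong-≡[] (suc L) ρ {τ} {τ′} p =
  ≡[]-trans (≗⇒≡[] (unfold τ)) (≡[]-trans step (≗⇒≡[] (≗ⱽ-sym (unfold τ′))))
  where
  ρ⁺ = λ π → ρ π ∘ suc
  IH = spliceⱽ-cong-≡[] L ρ⁺ p
  step : spliceⱽ 1 ρ (spliceⱽ L ρ⁺ τ) ≡[ _ ] spliceⱽ 1 ρ (spliceⱽ L ρ⁺ τ′)
  step ψ le = mk⇔ (spliceⱽ-letter ρ IH ψ le) (spliceⱽ-letter ρ (≡[]-sym IH) ψ le)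
  unfold : ∀ σ → spliceⱽ (suc L) ρ σ ≗ⱽ spliceⱽ 1 ρ (spliceⱽ L ρ⁺ σ)
  unfold σ π zero    = refl
  unfold σ π (suc i) = refl

-- Each `X` consumes one leading empty letter and one unit of depth. `U` costs nothing: by
-- induction, the added first position satisfies the same subformulas as the one after it.
stutter : ∀ L (τ : Valuation k) ψ → depth ψ < L →
  ⟦ spliceⱽ L 𝟘ⱽ τ ⟧ ⊨ᴹ ψ ⇔ ⟦ spliceⱽ (suc L) 𝟘ⱽ τ ⟧ ⊨ᴹ ψ
stutter (suc L) τ (a at π) le =
  mk⇔ (λ { (MaybeAny.just s) → MaybeAny.just s }) (λ { (MaybeAny.just s) → MaybeAny.just s })
stutter L τ (¬′ ψ) le = mk⇔ (λ s → s ∘ from (stutter L τ ψ le)) (λ s → s ∘ to (stutter L τ ψ le))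
stutter L τ (ψ ∨′ χ) le = mk⇔ (Sum.map (to ih₁) (to ih₂)) (Sum.map (from ih₁) (from ih₂))
  where
  ih₁ = stutter L τ ψ (m⊔n<o⇒m<o _ _ le)
  ih₂ = stutter L τ χ (m⊔n<o⇒n<o _ _ le)
stutter (suc L) τ (X ψ) (s≤s le) = stutter L τ ψ le
stutter (suc L) τ (ψ U χ) le = mk⇔ pad unpad
  where
  ih₁ = stutter (suc L) τ ψ (m⊔n<o⇒m<o _ _ le)
  ih₂ = stutter (suc L) τ χ (m⊔n<o⇒n<o _ _ le)
  pad : ⟦ spliceⱽ (suc L) 𝟘ⱽ τ ⟧ ⊨ᴹ ψ U χ → ⟦ spliceⱽ (suc (suc L)) 𝟘ⱽ τ ⟧ ⊨ᴹ ψ U χ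
  pad (zero  , s , f) = zero , to ih₂ s , λ _ ()
  pad (suc j , s , f) = suc (suc j) , s , λ where
    zero          _               → to ih₁ (f 0 z<s)
    (suc zero)    _               → f 0 z<s
    (suc (suc i)) (s≤s (s≤s i<j)) → f (suc i) (s≤s i<j)
  unpad : ⟦ spliceⱽ (suc (suc L)) 𝟘ⱽ τ ⟧ ⊨ᴹ ψ U χ → ⟦ spliceⱽ (suc L) 𝟘ⱽ τ ⟧ ⊨ᴹ ψ U χ
  unpad (zero  , s , f) = zero , from ih₂ s , λ _ ()
  unpad (suc zero    , s , f) = zero , s , λ _ ()
  unpad (suc (suc j) , s , f) = suc j , s , λ where
    zero    _         → f 1 (s≤s z<s)
    (suc i) (s≤s i<j) → f (suc (suc i)) (s≤s (s≤s i<j))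

stutter-≤ : ∀ {d L L′} (τ : Valuation k) → d < L → L ≤′ L′ → spliceⱽ L 𝟘ⱽ τ ≡[ d ] spliceⱽ L′ 𝟘ⱽ τ
stutter-≤ τ d<L ≤′-refl = ≗⇒≡[] λ _ _ → refl
stutter-≤ τ d<L (≤′-step L≤L′) = ≡[]-trans (stutter-≤ τ d<L L≤L′)
  λ ψ le → stutter _ τ ψ (≤-trans (s≤s le) (≤-trans d<L (≤′⇒≤ L≤L′)))

spliceⱽ-𝟘-cong : ∀ {d L L′} {τ τ′ : Valuation k} → d < L → d < L′ → τ ≡[ d ] τ′ →
  spliceⱽ L 𝟘ⱽ τ ≡[ d ] spliceⱽ L′ 𝟘ⱽ τ′
spliceⱽ-𝟘-cong {L = L} {L′} {τ} {τ′} d<L d<L′ p with ≤-total L L′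
... | inj₁ L≤L′ = ≡[]-trans (stutter-≤ τ d<L (≤⇒≤′ L≤L′)) (spliceⱽ-cong-≡[] L′ 𝟘ⱽ p)
... | inj₂ L′≤L = ≡[]-trans (spliceⱽ-cong-≡[] L 𝟘ⱽ p) (≡[]-sym (stutter-≤ τ′ d<L′ (≤⇒≤′ L′≤L)))

-- Trees and the traces of their leaves

data Tree : Set where
  leaf : Bool → Tree
  node : List Tree → Tree

private variable
  b     : Bool
  t     : Tree
  xs ys : List Tree

mutual
  data Leaf : Tree → Set where
    here  : Leaf (leaf b)
    below : Leaves xs → Leaf (node xs)

  data Leaves : List Tree → Set where
    first : Leaf t → Leaves (t ∷ xs)
    later : Leaves xs → Leaves (t ∷ xs)

mutual
  -- The length of the window that encodes the tree: a mark and a label for a leaf; a mark, then the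
  -- windows of the children, for a node.
  size : Tree → ℕ
  size (leaf _)  = 2
  size (node xs) = suc (sizes xs)

  sizes : List Tree → ℕ
  sizes []       = 0
  sizes (t ∷ xs) = size t + sizes xs

infixr 5 _∷ᵗ_

_∷ᵗ_ : Subset k → Trace k → Trace k
(x ∷ᵗ u) zero    = x
(x ∷ᵗ u) (suc i) = u i

label : Bool → Subset k
label b = if b then ⊤ else ⊥

mutual
  trace : Leaf t → Trace k
  trace (here {b}) = ⊤ ∷ᵗ label b ∷ᵗ 𝟘
  trace (below e)  = ⊤ ∷ᵗ traces e

  traces : Leaves xs → Trace k
  traces (first e)         = trace e
  traces (later {t = t} e) = splice (size t) 𝟘 (traces e)

mutual
  trace-vanishes : (e : Leaf t) → Vanishes {k} (size t) (trace e)
  trace-vanishes here      i = refl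
  trace-vanishes (below e) i = traces-vanishes e i

  traces-vanishes : (e : Leaves xs) → Vanishes {k} (sizes xs) (traces e)
  traces-vanishes (first {t} {xs} e) i =
    trans (cong (trace e) (+-assoc (size t) (sizes xs) i)) (trace-vanishes e (sizes xs + i))
  traces-vanishes (later {xs} {t} e) i =
    trans (cong (splice (size t) 𝟘 (traces e)) (+-assoc (size t) (sizes xs) i))
      (trans (splice-≥ (size t) 𝟘 (traces e) (sizes xs + i)) (traces-vanishes e i))

size>0 : ∀ t → 0 < size t
size>0 (leaf _) = z<s
size>0 (node _) = z<s

trace-head : (e : Leaf t) → trace {k = k} e 0 ≡ ⊤
trace-head here      = refl
trace-head (below _) = refl

sizes-++ : ∀ xs ys → sizes (xs ++ ys) ≡ sizes xs + sizes ys
sizes-++ []       ys = refl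
sizes-++ (t ∷ xs) ys = trans (cong (size t +_) (sizes-++ xs ys)) (sym (+-assoc (size t) _ _))

++⁺ˡ : Leaves xs → Leaves (xs ++ ys)
++⁺ˡ (first e) = first e
++⁺ˡ (later e) = later (++⁺ˡ e)

++⁺ʳ : ∀ xs → Leaves ys → Leaves (xs ++ ys)
++⁺ʳ []       e = e
++⁺ʳ (t ∷ xs) e = later (++⁺ʳ xs e)

splice-𝟘-+ : ∀ a b (u : Trace k) → splice a 𝟘 (splice b 𝟘 u) ≗ splice (a + b) 𝟘 u
splice-𝟘-+ a b u i = trans (sym (splice-assoc a b 𝟘 𝟘 u i))
  (splice-cong (a + b) (splice-𝟘 a) (λ _ → refl) i)

traces-++⁺ˡ : ∀ (e : Leaves xs) {ys} → traces {k = k} (++⁺ˡ {ys = ys} e) ≗ traces e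
traces-++⁺ˡ (first e)         i = refl
traces-++⁺ˡ (later {t = t} e) i = splice-cong (size t) (λ _ → refl) (traces-++⁺ˡ e) i

traces-++⁺ʳ : ∀ xs (e : Leaves ys) → traces {k = k} (++⁺ʳ xs e) ≗ splice (sizes xs) 𝟘 (traces e)
traces-++⁺ʳ []       e i = refl
traces-++⁺ʳ (t ∷ xs) e i = trans (splice-cong (size t) (λ _ → refl) (traces-++⁺ʳ xs e) i)
  (splice-𝟘-+ (size t) (sizes xs) (traces e) i)

-- Decomposing forests and counting copies

data SplitView (xs ys : List Tree) : Leaves (xs ++ ys) → Set where
  left  : (e : Leaves xs) → SplitView xs ys (++⁺ˡ e)
  right : (e : Leaves ys) → SplitView xs ys (++⁺ʳ xs e)

split : ∀ xs {ys} (e : Leaves (xs ++ ys)) → SplitView xs ys e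
split []       e         = right e
split (t ∷ xs) (first e) = left (first e)
split (t ∷ xs) (later e) with split xs e
... | left e′  = left (later e′)
... | right e′ = right e′

locate : ∀ p {t} (e : Leaves (replicate p t)) → ∃[ p₁ ] ∃[ p₂ ] Σ[ e′ ∈ Leaf t ]
  (p ≡ p₁ + suc p₂ × (∀ {k} → traces {k = k} e ≗ splice (sizes (replicate p₁ t)) 𝟘 (trace e′)))
locate (suc p) (first e) = 0 , p , e , refl , λ _ → refl
locate (suc p) {t} (later e) with p₁ , p₂ , e′ , refl , eq ← locate p e =
  suc p₁ , p₂ , e′ , refl , λ i →
    trans (splice-cong (size t) (λ _ → refl) eq i)
      (splice-𝟘-+ (size t) (sizes (replicate p₁ t)) (trace e′) i)

replicate-+ : ∀ {A : Set} p {q} {x : A} → replicate (p + q) x ≡ replicate p x ++ replicate q x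
replicate-+ zero    = refl
replicate-+ (suc p) = cong (_ ∷_) (replicate-+ p)

sizes-replicate : ∀ p t → p ≤ sizes (replicate p t)
sizes-replicate zero    t = z≤n
sizes-replicate (suc p) t = +-mono-≤ (size>0 t) (sizes-replicate p t)

carve : ∀ {a θ q} → a ≤ θ → suc (θ + θ) ≤ q → ∃[ b ] (q ≡ a + suc b × q ≡ b + suc a × θ ≤ b)
carve {a} {θ} {q} a≤θ le
  with b , refl ← m≤n⇒∃[o]m+o≡n (≤-trans (s≤s (≤-trans a≤θ (m≤m+n θ θ))) le) =
  b , sym (+-suc a b) , trans (cong suc (+-comm a b)) (sym (+-suc b a)) ,
  +-cancelˡ-≤ a _ _ (≤-trans (+-monoˡ-≤ θ a≤θ) (s≤s⁻¹ le))

≤⊎≤ : ∀ {θ} a b → suc (θ + θ) ≤ a + suc b → θ ≤ a ⊎ (a ≤ θ × θ ≤ b)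
≤⊎≤ {θ} a b le with ≤-total θ a
... | inj₁ θ≤a = inj₁ θ≤a
... | inj₂ a≤θ = inj₂ (a≤θ , +-cancelˡ-≤ a _ _
  (≤-trans (+-monoˡ-≤ θ a≤θ) (s≤s⁻¹ (≤-trans le (≤-reflexive (+-suc a b))))))

-- The game on forests and its composition

Position : ℕ → Set
Position k = List Tree × Valuation k

module _ {k : ℕ} (d : ℕ) where

  infix 4 _≈_

  -- Ranging over equivalent continuations makes the relation compose: in `Win-++`, the right-hand
  -- forest becomes part of the continuation of the left-hand one.
  _≈_ : Position k → Position k → Set
  (xs , ρ) ≈ (ys , σ) =
    ∀ {τ τ′} → τ ≡[ d ] τ′ → spliceⱽ (sizes xs) ρ τ ≡[ d ] spliceⱽ (sizes ys) σ τ′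

  -- The Ehrenfeucht–Fraïssé game for Σ_j-formulas with m quantifiers. The moves
  -- that place the empty trace serve composition: a leaf chosen in another part of
  -- the forest is empty on this part.
  Win : ℕ → ℕ → Position k → Position k → Set
  Win zero    m       P Q = P ≈ Q
  -- Blocks of quantifiers may be empty, so alternations can be spent without a move; each one swaps
  -- the two sides.
  Win (suc j) zero    P Q = Win j zero Q P
  Win (suc j) (suc m) P@(xs , ρ) Q@(ys , σ) =
      Win j (suc m) Q P
    × (∀ x → Win (suc j) m (xs , ρ [ x ≔ 𝟘 ]) (ys , σ [ x ≔ 𝟘 ]))
    × (∀ x (e : Leaves xs) → Σ[ e′ ∈ Leaves ys ]
         Win (suc j) m (xs , ρ [ x ≔ traces e ]) (ys , σ [ x ≔ traces e′ ]))

  Win-flip : ∀ j m {P Q} → Win (suc j) m P Q → Win j m Q P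
  Win-flip j zero    w = w
  Win-flip j (suc m) w = proj₁ w

  Win-resp : ∀ j m {xs ys ρ ρ′ σ σ′} → ρ ≗ⱽ ρ′ → σ ≗ⱽ σ′ →
    Win j m (xs , ρ) (ys , σ) → Win j m (xs , ρ′) (ys , σ′)
  Win-resp zero m {xs} {ys} p q w eq =
    ≡[]-trans (≗⇒≡[] λ π i → splice-cong (sizes xs) (λ i → sym (p π i)) (λ _ → refl) i)
      (≡[]-trans (w eq) (≗⇒≡[] λ π i → splice-cong (sizes ys) (q π) (λ _ → refl) i))
  Win-resp (suc j) zero p q w = Win-resp j zero q p w
  Win-resp (suc j) (suc m) p q (w , skip , move) =
      Win-resp j (suc m) q p w
    , (λ x → Win-resp (suc j) m (≔-cong x p λ _ → refl) (≔-cong x q λ _ → refl) (skip x))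
    , λ x e → map₂ (Win-resp (suc j) m (≔-cong x p λ _ → refl) (≔-cong x q λ _ → refl)) (move x e)

  Win-refl : ∀ j m {P} → Win j m P P
  Win-refl zero    m       {xs , ρ} = spliceⱽ-cong-≡[] (sizes xs) ρ
  Win-refl (suc j) zero    = Win-refl j zero
  Win-refl (suc j) (suc m) =
    Win-refl j (suc m) , (λ x → Win-refl (suc j) m) , λ x e → e , Win-refl (suc j) m

  -- A move into one part is answered by the strategy for that part, while the strategy for the
  -- other part sees the empty trace being placed.
  Win-++ : ∀ j m {xs xs′ ys ys′ ρ ρ′ σ σ′} →
    Win j m (xs , ρ) (xs′ , ρ′) → Win j m (ys , σ) (ys′ , σ′) →
    Win j m (xs ++ ys , spliceⱽ (sizes xs) ρ σ) (xs′ ++ ys′ , spliceⱽ (sizes xs′) ρ′ σ′)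
  Win-++ zero m {xs} {xs′} {ys} {ys′} {ρ} {ρ′} {σ} {σ′} w₁ w₂ {τ} {τ′} eq =
    ≡[]-trans (≗⇒≡[] (assoc xs ys ρ σ τ))
      (≡[]-trans (w₁ (w₂ eq)) (≗⇒≡[] (≗ⱽ-sym (assoc xs′ ys′ ρ′ σ′ τ′))))
    where
    assoc : ∀ xs ys ρ σ τ → spliceⱽ (sizes (xs ++ ys)) (spliceⱽ (sizes xs) ρ σ) τ ≗ⱽ
                            spliceⱽ (sizes xs) ρ (spliceⱽ (sizes ys) σ τ)
    assoc xs ys ρ σ τ π rewrite sizes-++ xs ys =
      splice-assoc (sizes xs) (sizes ys) (ρ π) (σ π) (τ π)
  Win-++ (suc j) zero w₁ w₂ = Win-++ j zero w₁ w₂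
  Win-++ (suc j) (suc m) {xs} {xs′} {ys} {ys′} {ρ} {ρ′} {σ} {σ′}
    (w₁ , skip₁ , move₁) (w₂ , skip₂ , move₂) =
      Win-++ j (suc m) w₁ w₂
    , (λ x → Win-resp (suc j) m
         (update xs ρ σ x {𝟘} {𝟘} (splice-𝟘 (sizes xs)))
         (update xs′ ρ′ σ′ x {𝟘} {𝟘} (splice-𝟘 (sizes xs′)))
         (Win-++ (suc j) m (skip₁ x) (skip₂ x)))
    , move
    where
    update : ∀ xs (ρ σ : Valuation k) x {u v w} → splice (sizes xs) u v ≗ w →
      spliceⱽ (sizes xs) (ρ [ x ≔ u ]) (σ [ x ≔ v ]) ≗ⱽ spliceⱽ (sizes xs) ρ σ [ x ≔ w ]
    update xs ρ σ x {u} {v} eq =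
      ≗ⱽ-trans (≔-splice (sizes xs) {ρ} {σ} x {u} {v}) (≔-cong x (λ _ _ → refl) eq)
    onˡ : ∀ {xs ys} (e : Leaves xs) → splice {k} (sizes xs) (traces e) 𝟘 ≗ traces (++⁺ˡ {ys = ys} e)
    onˡ {xs} e i = trans (splice-vanishes (sizes xs) {traces e} (traces-vanishes e) i)
      (sym (traces-++⁺ˡ e i))
    onʳ : ∀ xs {ys} (e : Leaves ys) → splice {k} (sizes xs) 𝟘 (traces e) ≗ traces (++⁺ʳ xs e)
    onʳ xs e i = sym (traces-++⁺ʳ xs e i)
    move : ∀ x (e : Leaves (xs ++ ys)) → Σ[ e′ ∈ Leaves (xs′ ++ ys′) ]
      Win (suc j) m (_ , spliceⱽ (sizes xs) ρ σ [ x ≔ traces e ])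
                    (_ , spliceⱽ (sizes xs′) ρ′ σ′ [ x ≔ traces e′ ])
    move x e with split xs e
    ... | left e₁ with e₁′ , w ← move₁ x e₁ = ++⁺ˡ e₁′ ,
      Win-resp (suc j) m (update xs ρ σ x {traces e₁} {𝟘} (onˡ e₁))
        (update xs′ ρ′ σ′ x {traces e₁′} {𝟘} (onˡ e₁′)) (Win-++ (suc j) m w (skip₂ x))
    ... | right e₂ with e₂′ , w ← move₂ x e₂ = ++⁺ʳ xs′ e₂′ ,
      Win-resp (suc j) m (update xs ρ σ x {𝟘} {traces e₂} (onʳ xs e₂))
        (update xs′ ρ′ σ′ x {𝟘} {traces e₂′} (onʳ xs′ e₂′)) (Win-++ (suc j) m (skip₁ x) w)

  infixr 5 _∷ⱽ_

  _∷ⱽ_ : (Var → Subset k) → Valuation k → Valuation k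
  (h ∷ⱽ ρ) π = h π ∷ᵗ ρ π

  -- During play `h` records the marks at the root: a variable gets `⊤` when its leaf lies below the
  -- root and `⊥` when the empty trace is placed. Both sides always carry the same `h`.
  Win-node : ∀ j m {xs ys ρ σ} h → Win j m (xs , ρ) (ys , σ) →
    Win j m ([ node xs ] , h ∷ⱽ ρ) ([ node ys ] , h ∷ⱽ σ)
  Win-node zero m {xs} {ys} {ρ} {σ} h w {τ} {τ′} eq =
    ≡[]-trans (≗⇒≡[] (unfold xs ρ τ))
      (≡[]-trans (spliceⱽ-cong-≡[] 1 (λ π _ → h π) (w eq)) (≗⇒≡[] (≗ⱽ-sym (unfold ys σ τ′))))
    where
    unfold : ∀ xs ρ τ → spliceⱽ (sizes [ node xs ]) (h ∷ⱽ ρ) τ ≗ⱽ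
                        spliceⱽ 1 (λ π _ → h π) (spliceⱽ (sizes xs) ρ τ)
    unfold xs ρ τ π rewrite +-identityʳ (sizes xs) = λ { zero → refl ; (suc i) → refl }
  Win-node (suc j) zero h w = Win-node j zero h w
  Win-node (suc j) (suc m) h (w , skip , move) =
      Win-node j (suc m) h w
    , (λ x → Win-resp (suc j) m (update x ⊥ λ { zero → refl ; (suc _) → refl })
         (update x ⊥ λ { zero → refl ; (suc _) → refl })
         (Win-node (suc j) m (h′ x ⊥) (skip x)))
    , λ where
        x (first (below e)) → let e′ , w′ = move x e in first (below e′) ,
          Win-resp (suc j) m (update x ⊤ λ _ → refl) (update x ⊤ λ _ → refl)
            (Win-node (suc j) m (h′ x ⊤) w′)
    where
    h′ : Var → Subset k → Var → Subset k
    h′ x l π = if does (π ≟ x) then l else h π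
    update : ∀ {ρ} x l {u w} → l ∷ᵗ u ≗ w → (h′ x l ∷ⱽ ρ [ x ≔ u ]) ≗ⱽ (h ∷ⱽ ρ) [ x ≔ w ]
    update x l eq π with does (π ≟ x)
    ... | true  = eq
    ... | false = λ _ → refl

  Win-node-𝟘 : ∀ j m {xs ys} → Win j m (xs , 𝟘ⱽ) (ys , 𝟘ⱽ) →
    Win j m ([ node xs ] , 𝟘ⱽ) ([ node ys ] , 𝟘ⱽ)
  Win-node-𝟘 j m w = Win-resp j m (λ _ → ⊥∷𝟘) (λ _ → ⊥∷𝟘) (Win-node j m (λ _ → ⊥) w)
    where
    ⊥∷𝟘 : ⊥ ∷ᵗ 𝟘 ≗ 𝟘
    ⊥∷𝟘 zero    = refl
    ⊥∷𝟘 (suc _) = refl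

  -- Replicated subtrees and thresholds

  Win-between : ∀ j m {us vs xs xs′ t t′ ys ys′} →
    us ≡ xs ++ t ∷ ys → vs ≡ xs′ ++ t′ ∷ ys′ →
    Win j m (xs , 𝟘ⱽ) (xs′ , 𝟘ⱽ) → Win j m ([ t ] , 𝟘ⱽ) ([ t′ ] , 𝟘ⱽ) →
    Win j m (ys , 𝟘ⱽ) (ys′ , 𝟘ⱽ) →
    Win j m (us , 𝟘ⱽ) (vs , 𝟘ⱽ)
  Win-between j m {xs = xs} {xs′} {t} {t′} refl refl w₁ w₂ w₃ =
    Win-resp j m (empty (sizes xs) (sizes [ t ])) (empty (sizes xs′) (sizes [ t′ ]))
      (Win-++ j m w₁ (Win-++ j m w₂ w₃))
    where
    empty : ∀ a b → spliceⱽ a 𝟘ⱽ (spliceⱽ b 𝟘ⱽ 𝟘ⱽ) ≗ⱽ 𝟘ⱽ {k}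
    empty a b π i = trans (splice-𝟘-+ a b 𝟘 i) (splice-𝟘 (a + b) i)

  -- The answer is the same leaf of a copy of t in the other forest; from then on the parts left and
  -- right of that copy are played separately.
  Win-answer : ∀ j m {us vs xs xs′ t ys ys′} →
    us ≡ xs ++ t ∷ ys → vs ≡ xs′ ++ t ∷ ys′ →
    Win j m (xs , 𝟘ⱽ) (xs′ , 𝟘ⱽ) → Win j m (ys , 𝟘ⱽ) (ys′ , 𝟘ⱽ) →
    ∀ x (e : Leaves us) (e₀ : Leaf t) → traces e ≗ splice (sizes xs) 𝟘 (trace e₀) →
    Σ[ e′ ∈ Leaves vs ] Win j m (us , 𝟘ⱽ [ x ≔ traces e ]) (vs , 𝟘ⱽ [ x ≔ traces e′ ])
  Win-answer j m {xs = xs} {xs′} {t} refl refl w₁ w₂ x e e₀ eq =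
    ++⁺ʳ xs′ (first e₀) ,
    Win-resp j m (place xs λ i → sym (eq i)) (place xs′ λ i → sym (traces-++⁺ʳ xs′ (first e₀) i))
      (Win-++ j m w₁ (Win-++ j m (Win-refl j m {[ t ] , 𝟘ⱽ [ x ≔ trace e₀ ]}) w₂))
    where
    place : ∀ xs {u} → splice (sizes xs) 𝟘 (trace e₀) ≗ u →
      spliceⱽ (sizes xs) 𝟘ⱽ (spliceⱽ (sizes [ t ]) (𝟘ⱽ [ x ≔ trace e₀ ]) 𝟘ⱽ) ≗ⱽ 𝟘ⱽ [ x ≔ u ]
    place xs p π with does (π ≟ x)
    ... | true  = λ i → trans (splice-cong (sizes xs) (λ _ → refl) short i) (p i)
      where short = splice-vanishes (sizes [ t ]) {trace e₀} (traces-vanishes {xs = [ t ]} (first e₀))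
    ... | false = λ i → trans (splice-𝟘-+ (sizes xs) (sizes [ t ]) 𝟘 i)
                          (splice-𝟘 (sizes xs + sizes [ t ]) i)

  -- More than d empty letters look alike at the end of the game. A move cuts a run of copies around
  -- the chosen one, so 2θ + 1 copies always leave at least θ on one side.
  threshold : ℕ → ℕ
  threshold zero    = suc d
  threshold (suc m) = suc (threshold m + threshold m)

  infix 4 _~[_]_

  -- The usual invariant for the game on finite linear orders: equal counts, or counts too large to
  -- be told apart with m moves.
  _~[_]_ : ℕ → ℕ → ℕ → Set
  p ~[ m ] q = p ≡ q ⊎ (threshold m ≤ p × threshold m ≤ q)

  ~-sym : ∀ {m p q} → p ~[ m ] q → q ~[ m ] p
  ~-sym (inj₁ p)       = inj₁ (sym p)
  ~-sym (inj₂ (p , q)) = inj₂ (q , p)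

  threshold>d : ∀ m → d < threshold m
  threshold>d zero    = ≤-refl
  threshold>d (suc m) = m≤n⇒m≤1+n (≤-trans (threshold>d m) (m≤m+n _ _))

  threshold-≤ : ∀ m → threshold m ≤ threshold (suc m)
  threshold-≤ m = m≤n⇒m≤1+n (m≤m+n _ _)

  -- The count b imitates a, cut off at the threshold, and c is what remains. Both orders of the sum
  -- are given because the imitated side may be the left or the right one.
  ~-carve : ∀ m {q} a → threshold (suc m) ≤ q →
    ∃[ b ] ∃[ c ] (q ≡ b + suc c × q ≡ c + suc b × a ~[ m ] b × threshold m ≤ c)
  ~-carve m a le with ≤-total a (threshold m)
  ... | inj₁ a≤θ with c , p , q , θ≤c ← carve a≤θ le = a , c , p , q , inj₁ refl , θ≤c
  ... | inj₂ θ≤a with c , p , q , θ≤c ← carve ≤-refl le =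
    threshold m , c , p , q , inj₂ (θ≤a , ≤-refl) , θ≤c

  ~-split : ∀ m p₁ p₂ {q} → (p₁ + suc p₂) ~[ suc m ] q →
    ∃[ q₁ ] ∃[ q₂ ] (q ≡ q₁ + suc q₂ × p₁ ~[ m ] q₁ × p₂ ~[ m ] q₂)
  ~-split m p₁ p₂ (inj₁ refl) = p₁ , p₂ , refl , inj₁ refl , inj₁ refl
  ~-split m p₁ p₂ (inj₂ (θ≤p , θ≤q)) with ≤⊎≤ p₁ p₂ θ≤p
  ... | inj₁ θ≤p₁ with q₂ , q₁ , _ , eq , p₂~q₂ , θ≤q₁ ← ~-carve m p₂ θ≤q =
    q₁ , q₂ , eq , inj₂ (θ≤p₁ , θ≤q₁) , p₂~q₂
  ... | inj₂ (_ , θ≤p₂) with q₁ , q₂ , eq , _ , p₁~q₁ , θ≤q₂ ← ~-carve m p₁ θ≤q =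
    q₁ , q₂ , eq , p₁~q₁ , inj₂ (θ≤p₂ , θ≤q₂)

  -- Untouched copies contribute only empty letters, so at the end long runs agree by stuttering.
  -- Before that, a move cuts both runs into matching pieces.
  Win-replicate : ∀ j m t {p q} → p ~[ m ] q → Win j m (replicate p t , 𝟘ⱽ) (replicate q t , 𝟘ⱽ)
  Win-replicate zero m t {p} (inj₁ refl) = Win-refl zero m {replicate p t , 𝟘ⱽ}
  Win-replicate zero m t {p} {q} (inj₂ (θ≤p , θ≤q)) = spliceⱽ-𝟘-cong (long θ≤p) (long θ≤q)
    where
    long : ∀ {p} → threshold m ≤ p → d < sizes (replicate p t)
    long θ≤p = ≤-trans (threshold>d m) (≤-trans θ≤p (sizes-replicate _ t))
  Win-replicate (suc j) zero t p~q = Win-replicate j zero t (~-sym {zero} p~q)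
  Win-replicate (suc j) (suc m) t {p} {q} p~q =
      Win-replicate j (suc m) t (~-sym {suc m} p~q)
    , (λ x → Win-resp (suc j) m (≗ⱽ-sym (≔-𝟘 x)) (≗ⱽ-sym (≔-𝟘 x))
         (Win-replicate (suc j) m t (weaken p~q)))
    , move
    where
    weaken : p ~[ suc m ] q → p ~[ m ] q
    weaken = Sum.map₂ λ (a , b) → ≤-trans (threshold-≤ m) a , ≤-trans (threshold-≤ m) b
    move : ∀ x (e : Leaves (replicate p t)) → _
    move x e with p₁ , p₂ , e₀ , refl , eq ← locate p e
             with q₁ , q₂ , refl , p₁~q₁ , p₂~q₂ ← ~-split m p₁ p₂ p~q =
      Win-answer (suc j) m (replicate-+ p₁) (replicate-+ q₁)
        (Win-replicate (suc j) m t p₁~q₁) (Win-replicate (suc j) m t p₂~q₂) x e e₀ eq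

  -- The odd child `t′` is kept inside a long run that no move has touched. When the roles are
  -- swapped, it is paired with a copy of t inside the corresponding run of the other forest, and
  -- the assumed strategy takes over. The bound on p is one level higher because that run is then
  -- cut in two around this copy.
  Win-replace : ∀ j M t t′ → (∀ m → threshold m ≤ M → Win j m ([ t′ ] , 𝟘ⱽ) ([ t ] , 𝟘ⱽ)) →
    ∀ m {p x y} → threshold m ≤ M → threshold (suc m) ≤ p → threshold m ≤ x → threshold m ≤ y →
    Win (suc j) m (replicate p t , 𝟘ⱽ) (replicate x t ++ t′ ∷ replicate y t , 𝟘ⱽ)
  Win-replace j M t t′ w = go
    where
    flipped : ∀ m {p x y} → threshold m ≤ M →
      threshold (suc m) ≤ p → threshold m ≤ x → threshold m ≤ y →
      Win j m (replicate x t ++ t′ ∷ replicate y t , 𝟘ⱽ) (replicate p t , 𝟘ⱽ)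
    flipped m θ≤M θ≤p θ≤x θ≤y with b , refl , _ , θ≤b ← carve (≤-refl {threshold m}) θ≤p =
      Win-between j m refl (replicate-+ (threshold m))
        (Win-replicate j m t (inj₂ (θ≤x , ≤-refl))) (w m θ≤M)
        (Win-replicate j m t (inj₂ (θ≤y , θ≤b)))
    go : ∀ m {p x y} → threshold m ≤ M → threshold (suc m) ≤ p → threshold m ≤ x → threshold m ≤ y →
      Win (suc j) m (replicate p t , 𝟘ⱽ) (replicate x t ++ t′ ∷ replicate y t , 𝟘ⱽ)
    go zero θ≤M θ≤p θ≤x θ≤y = flipped zero θ≤M θ≤p θ≤x θ≤y
    go (suc m) {p} {x} {y} θ≤M θ≤p θ≤x θ≤y =
        flipped (suc m) θ≤M θ≤p θ≤x θ≤y
      , (λ z → Win-resp (suc j) m (≗ⱽ-sym (≔-𝟘 z)) (≗ⱽ-sym (≔-𝟘 z))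
           (go m (lower θ≤M) (≤-trans (threshold-≤ (suc m)) θ≤p) (lower θ≤x) (lower θ≤y)))
      , move
      where
      lower : ∀ {n} → threshold (suc m) ≤ n → threshold m ≤ n
      lower = ≤-trans (threshold-≤ m)
      move : ∀ z (e : Leaves (replicate p t)) → _
      move z e with p₁ , p₂ , e₀ , refl , eq ← locate p e with ≤⊎≤ {threshold (suc m)} p₁ p₂ θ≤p
      -- The run to the left of the chosen copy is long enough to face `t′`, so the answer is taken
      -- to the right of `t′`; the other case is symmetric.
      ... | inj₁ θ≤p₁ with y₂ , y₁ , _ , refl , p₂~y₂ , θ≤y₁ ← ~-carve m p₂ θ≤y =
        Win-answer (suc j) m (replicate-+ p₁)
          (trans (cong (λ zs → replicate x t ++ t′ ∷ zs) (replicate-+ y₁))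
            (sym (++-assoc (replicate x t) _ _)))
          (go m (lower θ≤M) θ≤p₁ (lower θ≤x) θ≤y₁) (Win-replicate (suc j) m t p₂~y₂) z e e₀ eq
      ... | inj₂ (_ , θ≤p₂) with x₁ , x₂ , refl , _ , p₁~x₁ , θ≤x₂ ← ~-carve m p₁ θ≤x =
        Win-answer (suc j) m (replicate-+ p₁)
          (trans (cong (_++ t′ ∷ replicate y t) (replicate-+ x₁)) (++-assoc (replicate x₁ t) _ _))
          (Win-replicate (suc j) m t p₁~x₁) (go m (lower θ≤M) θ≤p₂ θ≤x₂ (lower θ≤y)) z e e₀ eq

-- The two families of trees

treeᴬ treeᴮ : ℕ → ℕ → Tree
treeᴬ M zero    = leaf true
treeᴬ M (suc j) = node (replicate (suc (M + M)) (treeᴮ M j))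
treeᴮ M zero    = leaf false
treeᴮ M (suc j) = node (replicate M (treeᴮ M j) ++ treeᴬ M j ∷ replicate M (treeᴮ M j))

Win-trees : ∀ {k} d M j m → threshold {k} d m ≤ M →
  Win {k} d j m ([ treeᴬ M j ] , 𝟘ⱽ) ([ treeᴮ M j ] , 𝟘ⱽ)
-- No variable holds a leaf, so neither label is visible: both windows consist of two empty letters.
Win-trees d M zero m θ≤M = spliceⱽ-cong-≡[] 2 𝟘ⱽ
Win-trees d M (suc j) m θ≤M =
  Win-node-𝟘 d (suc j) m
    (Win-replace d j M (treeᴮ M j) (treeᴬ M j) (Win-trees d M j) m
      -- The 2M + 1 children on one side reach `threshold (suc m)`; the M copies on either side of
      -- the odd child reach `threshold m`.
      θ≤M (s≤s (+-mono-≤ θ≤M θ≤M)) θ≤M θ≤M)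

-- From winning strategies to formulas

forestTraces : List Tree → TraceSet k
forestTraces xs .Member u = Σ[ e ∈ Leaves xs ] u ≗ traces e
forestTraces xs .respects eq (e , p) = e , λ i → trans (sym (eq i)) (p i)

valuation-↦ : ∀ (Π : Assignment k) x t → valuation (Π [ x ↦ t ]) ≗ⱽ valuation Π [ x ≔ t ]
valuation-↦ Π x t π i with does (π ≟ x)
... | true  = refl
... | false = refl

quantifiers : Formula k → ℕ
quantifiers (matrix ψ) = 0
quantifiers (∃′ π φ)   = suc (quantifiers φ)
quantifiers (∀′ π φ)   = suc (quantifiers φ)

depthᶠ : Formula k → ℕ
depthᶠ (matrix ψ) = depth ψ
depthᶠ (∃′ π φ)   = depthᶠ φ
depthᶠ (∀′ π φ)   = depthᶠ φ

module _ {k : ℕ} (d : ℕ) where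

  Denotes : Assignment k → Position k → Set
  Denotes Π (xs , ρ) = valuation Π ≗ⱽ spliceⱽ (sizes xs) ρ 𝟘ⱽ

  Denotes-↦ : ∀ (Π : Assignment k) {xs ρ} → Denotes Π (xs , ρ) →
    ∀ x {t} (e : Leaves xs) → t ≗ traces e → Denotes (Π [ x ↦ t ]) (xs , ρ [ x ≔ traces e ])
  Denotes-↦ Π {xs} {ρ} D x {t} e eq π i = trans (valuation-↦ Π x t π i) (update π i)
    where
    update : valuation Π [ x ≔ t ] ≗ⱽ spliceⱽ (sizes xs) (ρ [ x ≔ traces e ]) 𝟘ⱽ
    update π with does (π ≟ x)
    ... | true  = λ i → trans (eq i)
                    (sym (splice-vanishes (sizes xs) {traces e} (traces-vanishes e) i))
    ... | false = D π

  mutual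
    -- Existential witnesses are carried from left to right by the strategy. For a universal
    -- quantifier, an instance on the left is answered on the right, where the formula is known. The
    -- end of a block swaps the sides.
    Σ-transfer : ∀ j m {xs ys ρ σ} → Win d j m (xs , ρ) (ys , σ) →
      ∀ {φ} → IsΣ j φ → quantifiers φ ≤ m → depthᶠ φ ≤ d →
      ∀ Π Π′ → Denotes Π (xs , ρ) → Denotes Π′ (ys , σ) →
      forestTraces xs , Π ⊨ᶠ φ → forestTraces ys , Π′ ⊨ᶠ φ
    Σ-transfer zero m w (ψ , refl) _ le Π Π′ D D′ s =
      ⊨-resp-≋ ψ (≗ⱽ-sym D′) (to (w (≗⇒≡[] λ _ _ → refl) ψ le) (⊨-resp-≋ ψ D s))
    Σ-transfer (suc j) m w (πs , χ , refl , h) = ∃*-transfer j m w πs h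

    ∃*-transfer : ∀ j m {xs ys ρ σ} → Win d (suc j) m (xs , ρ) (ys , σ) →
      ∀ πs {χ} → IsΠ j χ → quantifiers (∃* πs χ) ≤ m → depthᶠ (∃* πs χ) ≤ d →
      ∀ Π Π′ → Denotes Π (xs , ρ) → Denotes Π′ (ys , σ) →
      forestTraces xs , Π ⊨ᶠ ∃* πs χ → forestTraces ys , Π′ ⊨ᶠ ∃* πs χ
    ∃*-transfer j m w [] h q le Π Π′ D D′ = Π-transfer j m (Win-flip d j m w) h q le Π′ Π D′ D
    ∃*-transfer j (suc m) (_ , _ , move) (π ∷ πs) h (s≤s q) le Π Π′ D D′ (t , (e , eq) , s)
      with e′ , w ← move π e =
      traces e′ , (e′ , λ _ → refl) ,
      ∃*-transfer j m w πs h q le _ _ (Denotes-↦ Π D π e eq) (Denotes-↦ Π′ D′ π e′ λ _ → refl) s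

    Π-transfer : ∀ j m {xs ys ρ σ} → Win d j m (xs , ρ) (ys , σ) →
      ∀ {φ} → IsΠ j φ → quantifiers φ ≤ m → depthᶠ φ ≤ d →
      ∀ Π Π′ → Denotes Π (xs , ρ) → Denotes Π′ (ys , σ) →
      forestTraces ys , Π′ ⊨ᶠ φ → forestTraces xs , Π ⊨ᶠ φ
    Π-transfer zero m w (ψ , refl) _ le Π Π′ D D′ s =
      ⊨-resp-≋ ψ (≗ⱽ-sym D) (from (w (≗⇒≡[] λ _ _ → refl) ψ le) (⊨-resp-≋ ψ D′ s))
    Π-transfer (suc j) m w (πs , χ , refl , h) = ∀*-transfer j m w πs h

    ∀*-transfer : ∀ j m {xs ys ρ σ} → Win d (suc j) m (xs , ρ) (ys , σ) →
      ∀ πs {χ} → IsΣ j χ → quantifiers (∀* πs χ) ≤ m → depthᶠ (∀* πs χ) ≤ d →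
      ∀ Π Π′ → Denotes Π (xs , ρ) → Denotes Π′ (ys , σ) →
      forestTraces ys , Π′ ⊨ᶠ ∀* πs χ → forestTraces xs , Π ⊨ᶠ ∀* πs χ
    ∀*-transfer j m w [] h q le Π Π′ D D′ = Σ-transfer j m (Win-flip d j m w) h q le Π′ Π D′ D
    ∀*-transfer j (suc m) (_ , _ , move) (π ∷ πs) h (s≤s q) le Π Π′ D D′ s t (e , eq)
      with e′ , w ← move π e =
      ∀*-transfer j m w πs h q le _ _ (Denotes-↦ Π D π e eq) (Denotes-↦ Π′ D′ π e′ λ _ → refl)
        (s (traces e′) (e′ , λ _ → refl))

-- Finiteness of sets of traces with a common bound

vectors : ∀ {A : Set} → List A → ∀ n → List (Vec A n)
vectors as zero    = [ Vec.[] ]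
vectors as (suc n) = cartesianProductWith Vec._∷_ as (vectors as n)

∈-vectors : ∀ {A : Set} {as : List A} → (∀ a → a ∈ˡ as) → ∀ {n} (v : Vec A n) → v ∈ˡ vectors as n
∈-vectors all Vec.[]      = here refl
∈-vectors all (a Vec.∷ v) = ∈-cartesianProductWith⁺ Vec._∷_ (all a) (∈-vectors all v)

subsets : ∀ k → List (Subset k)
subsets = vectors (true ∷ false ∷ [])

∈-subsets : (s : Subset k) → s ∈ˡ subsets k
∈-subsets = ∈-vectors λ { true → here refl ; false → there (here refl) }

fromVec : ∀ {n} → Vec (Subset k) n → Trace k
fromVec Vec.[]      = 𝟘
fromVec (s Vec.∷ v) = s ∷ᵗ fromVec v

toVec : Trace k → ∀ n → Vec (Subset k) n
toVec t zero    = Vec.[]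
toVec t (suc n) = t 0 Vec.∷ toVec (t ∘ suc) n

fromVec-toVec : ∀ (t : Trace k) n → Vanishes n t → t ≗ fromVec (toVec t n)
fromVec-toVec t zero    p i       = p i
fromVec-toVec t (suc n) p zero    = refl
fromVec-toVec t (suc n) p (suc i) = fromVec-toVec (t ∘ suc) n p i

vanishing⇒Finite : ∀ {T : TraceSet k} n → (∀ t → t ∈ᵀ T → Vanishes n t) → Finite T
vanishing⇒Finite n h = map fromVec (vectors (subsets _) n) , λ t t∈T →
  ListAny.map (λ eq i → trans (fromVec-toVec t n (h t t∈T) i) (cong-app eq i))
    (∈-map⁺ fromVec (∈-vectors ∈-subsets (toVec t n)))

vanishes⇒EventuallyEmpty : ∀ {n} {t : Trace k} → Vanishes n t → EventuallyEmpty t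
vanishes⇒EventuallyEmpty {n = n} {t} h =
  n , λ j n≤j → let i , eq = m≤n⇒∃[o]m+o≡n n≤j in trans (cong t (sym eq)) (h i)

-- Alternating quantifier prefixes

mutual
  ∀∃ : ℕ → Matrix k → Formula k
  ∀∃ zero    ψ = matrix ψ
  ∀∃ (suc j) ψ = ∀′ j (∃∀ j ψ)

  ∃∀ : ℕ → Matrix k → Formula k
  ∃∀ zero    ψ = matrix ψ
  ∃∀ (suc j) ψ = ∃′ j (∀∃ j ψ)

mutual
  ∀∃-IsΠ : ∀ j {ψ : Matrix k} → IsΠ j (∀∃ j ψ)
  ∀∃-IsΠ zero    = _ , refl
  ∀∃-IsΠ (suc j) = [ j ] , _ , refl , ∃∀-IsΣ j

  ∃∀-IsΣ : ∀ j {ψ : Matrix k} → IsΣ j (∃∀ j ψ)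
  ∃∀-IsΣ zero    = _ , refl
  ∃∀-IsΣ (suc j) = [ j ] , _ , refl , ∀∃-IsΠ j

mutual
  ∀∃-FreeIn : ∀ j {ψ : Matrix k} {π} → FreeIn π (∀∃ j ψ) → OccursIn π ψ × j ≤ π
  ∀∃-FreeIn zero    o        = o , z≤n
  ∀∃-FreeIn (suc j) (≢j , f) with o , j≤π ← ∃∀-FreeIn j f = o , ≤∧≢⇒< j≤π (≢j ∘ sym)

  ∃∀-FreeIn : ∀ j {ψ : Matrix k} {π} → FreeIn π (∃∀ j ψ) → OccursIn π ψ × j ≤ π
  ∃∀-FreeIn zero    o        = o , z≤n
  ∃∀-FreeIn (suc j) (≢j , f) with o , j≤π ← ∀∃-FreeIn j f = o , ≤∧≢⇒< j≤π (≢j ∘ sym)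

mutual
  ∀∃-¬-∃∀ : ∀ j {ψ} {T : TraceSet k} {Π} → T , Π ⊨ᶠ ∀∃ j ψ → ¬ (T , Π ⊨ᶠ ∃∀ j (¬′ ψ))
  ∀∃-¬-∃∀ zero    s ¬s            = ¬s s
  ∀∃-¬-∃∀ (suc j) s (t , t∈T , s′) = ∃∀-¬-∀∃ j (s t t∈T) s′

  ∃∀-¬-∀∃ : ∀ j {ψ} {T : TraceSet k} {Π} → T , Π ⊨ᶠ ∃∀ j ψ → ¬ (T , Π ⊨ᶠ ∀∃ j (¬′ ψ))
  ∃∀-¬-∀∃ zero    s ¬s             = ¬s s
  ∃∀-¬-∀∃ (suc j) (t , t∈T , s) s′ = ∀∃-¬-∃∀ j s (s′ t t∈T)

-- Describes the assignments that can arise from Π once the variables below j have been bound to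
-- members of T.
Extends : TraceSet k → ℕ → Assignment k → Assignment k → Set
Extends T j Π Π′ =
  (∀ π → j ≤ π → valuation Π′ π ≗ valuation Π π) × (∀ π → π < j → valuation Π′ π ∈ᵀ T)

Extends-↦ : ∀ {T : TraceSet k} {j Π Π′ t} → Extends T j (Π [ j ↦ t ]) Π′ → valuation Π′ j ≗ t
Extends-↦ {j = j} {Π} {Π′} {t} (above , _) i =
  trans (above j ≤-refl i) (trans (valuation-↦ Π j t j i)
    (cong (λ b → (if b then t else valuation Π j) i) (dec-true (j ≟ j) refl)))

Extends-suc : ∀ {T : TraceSet k} {j Π Π′ t} → t ∈ᵀ T → Extends T j (Π [ j ↦ t ]) Π′ →
  Extends T (suc j) Π Π′
Extends-suc {T = T} {j} {Π} {Π′} {t} t∈T ext@(above , under) = above′ , under′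
  where
  above′ : ∀ π → j < π → valuation Π′ π ≗ valuation Π π
  above′ π j<π i = trans (above π (<⇒≤ j<π) i) (trans (valuation-↦ Π j t π i)
    (cong (λ b → (if b then t else valuation Π π) i) (dec-false (π ≟ j) (>⇒≢ j<π))))
  under′ : ∀ π → π < suc j → valuation Π′ π ∈ᵀ T
  under′ π (s≤s π≤j) with m≤n⇒m<n∨m≡n π≤j
  ... | inj₁ π<j  = under π π<j
  ... | inj₂ refl = respects T (λ i → sym (Extends-↦ {T = T} {Π = Π} {Π′} ext i)) t∈T

mutual
  -- Used once the truth of the matrix is settled while quantifiers remain; t serves as witness for
  -- the existential ones.
  ∀∃-valid : ∀ j {ψ} {T : TraceSet k} {Π t} → t ∈ᵀ T →
    (∀ Π′ → Extends T j Π Π′ → Π′ ⊨ᴹ ψ) → T , Π ⊨ᶠ ∀∃ j ψ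
  ∀∃-valid zero    t∈T h = h _ ((λ _ _ _ → refl) , λ _ ())
  ∀∃-valid (suc j) {T = T} {Π} t∈T h u u∈T =
    ∃∀-valid j t∈T λ Π′ ext → h Π′ (Extends-suc {T = T} {Π = Π} {Π′} u∈T ext)

  ∃∀-valid : ∀ j {ψ} {T : TraceSet k} {Π t} → t ∈ᵀ T →
    (∀ Π′ → Extends T j Π Π′ → Π′ ⊨ᴹ ψ) → T , Π ⊨ᶠ ∃∀ j ψ
  ∃∀-valid zero    t∈T h = h _ ((λ _ _ _ → refl) , λ _ ())
  ∃∀-valid (suc j) {T = T} {Π} {t} t∈T h =
    t , t∈T , ∀∃-valid j t∈T λ Π′ ext → h Π′ (Extends-suc {T = T} {Π = Π} {Π′} t∈T ext)

mutual
  -- Instantiating the universal quantifiers with t leads to a single assignment, from which the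
  -- position demanded by `U` in `body` can be read off.
  ∀∃-witness : ∀ j {ψ} {T : TraceSet k} {Π t} → t ∈ᵀ T →
    T , Π ⊨ᶠ ∀∃ j ψ → ∃[ Π′ ] (Extends T j Π Π′ × Π′ ⊨ᴹ ψ)
  ∀∃-witness zero    t∈T s = _ , ((λ _ _ _ → refl) , λ _ ()) , s
  ∀∃-witness (suc j) {T = T} {Π} {t} t∈T s with Π′ , ext , s′ ← ∃∀-witness j t∈T (s t t∈T) =
    Π′ , Extends-suc {T = T} {Π = Π} {Π′} t∈T ext , s′

  ∃∀-witness : ∀ j {ψ} {T : TraceSet k} {Π t} → t ∈ᵀ T →
    T , Π ⊨ᶠ ∃∀ j ψ → ∃[ Π′ ] (Extends T j Π Π′ × Π′ ⊨ᴹ ψ)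
  ∃∀-witness zero    t∈T s = _ , ((λ _ _ _ → refl) , λ _ ()) , s
  ∃∀-witness (suc j) {T = T} {Π} t∈T (u , u∈T , s) with Π′ , ext , s′ ← ∀∃-witness j t∈T s =
    Π′ , Extends-suc {T = T} {Π = Π} {Π′} u∈T ext , s′

-- The separating sentence

infix 9 marked_
infixr 8 ◇_

marked_ : Var → Matrix (suc k)
marked π = zero at π

-- "Eventually". The left argument of `U` is a tautology; its double negation makes it provable
-- constructively.
◇_ : Matrix (suc k) → Matrix (suc k)
◇ ψ = (¬′ ¬′ (marked 0 ∨′ ¬′ marked 0)) U ψ

nonempty : Var → Matrix (suc k)
nonempty π = foldr (λ a ψ → a at π ∨′ ψ) (marked π) (allFin _)

-- Evaluated where the window of treeᴬ M j starts, with the variables below j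
-- ranging over leaves and alternately quantified, starting with ∀, this holds;
-- at treeᴮ M j it fails.
alternates : ℕ → Matrix (suc k)
alternates zero    = X (marked 0)
alternates (suc j) = ¬′ marked j ∨′ X (¬′ marked j U ¬′ (¬′ marked j ∨′ alternates j))

-- A conjunction by De Morgan: z is marked now, z is never marked later, and x is empty after the
-- two positions that a last leaf occupies.
bounds : Var → Var → Matrix (suc k)
bounds z x = ¬′ (¬′ marked z ∨′ (X ◇ (marked z) ∨′ X X ◇ (nonempty x)))

-- The position of the last mark of the trace z bounds all traces. It is the
-- witness of a positive occurrence of U, hence can be extracted constructively.
body : ℕ → Matrix (suc k)
body n = (¬′ marked (suc n) ∨′ X (alternates (suc n))) U bounds (suc n) n

-- The outer `∃` and the n + 1 alternating quantifiers starting with `∀` give n + 2 blocks, so this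
-- sentence serves the parameter `suc n` of the theorem.
separating : ℕ → Formula (suc k)
separating n = ∃′ (suc n) (∀∃ (suc n) (body n))

nonempty-OccursIn : ∀ {π x} → OccursIn π (nonempty {k} x) → π ≡ x
nonempty-OccursIn {k} {π} {x} = go (allFin (suc k))
  where
  go : ∀ as → OccursIn π (foldr (λ a ψ → a at x ∨′ ψ) (marked x) as) → π ≡ x
  go []       p        = p
  go (a ∷ as) (inj₁ p) = p
  go (a ∷ as) (inj₂ p) = go as p

◇-OccursIn : ∀ {π} {ψ : Matrix (suc k)} → OccursIn π (◇ ψ) → π ≡ 0 ⊎ OccursIn π ψ
◇-OccursIn (inj₁ (inj₁ p)) = inj₁ p
◇-OccursIn (inj₁ (inj₂ p)) = inj₁ p
◇-OccursIn (inj₂ p)        = inj₂ p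

alternates-OccursIn : ∀ j {π} → OccursIn π (alternates {k} j) → π ≤ j
alternates-OccursIn zero    refl                             = z≤n
alternates-OccursIn (suc j) (inj₁ refl)                      = n≤1+n j
alternates-OccursIn (suc j) (inj₂ (inj₁ refl))               = n≤1+n j
alternates-OccursIn (suc j) (inj₂ (inj₂ (inj₁ refl)))        = n≤1+n j
alternates-OccursIn (suc j) (inj₂ (inj₂ (inj₂ p)))           = m≤n⇒m≤1+n (alternates-OccursIn j p)

body-OccursIn : ∀ n {π} → OccursIn π (body {k} n) → π ≤ suc n
body-OccursIn n (inj₁ (inj₁ refl)) = ≤-refl
body-OccursIn {k} n (inj₁ (inj₂ p)) = alternates-OccursIn {k} (suc n) p
body-OccursIn n (inj₂ (inj₁ refl)) = ≤-refl
body-OccursIn {k} n (inj₂ (inj₂ (inj₁ p))) with ◇-OccursIn {k} {ψ = marked (suc n)} p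
... | inj₁ refl = z≤n
... | inj₂ refl = ≤-refl
body-OccursIn {k} n (inj₂ (inj₂ (inj₂ p))) with ◇-OccursIn {k} {ψ = nonempty n} p
... | inj₁ refl = z≤n
... | inj₂ q    = ≤-trans (≤-reflexive (nonempty-OccursIn {k} q)) (n≤1+n n)

separating-IsΣSentence : ∀ n → IsΣSentence {suc k} (suc (suc n)) (separating n)
separating-IsΣSentence {k} n = ([ suc n ] , _ , refl , ∀∃-IsΠ (suc n)) , closed
  where
  closed : Sentence (separating {k} n)
  closed π (≢n , f) with o , n<π ← ∀∃-FreeIn (suc n) f =
    ≢n (≤-antisym (body-OccursIn {k} n o) n<π)

⊨-◇ : ∀ ψ (Π : Assignment (suc k)) i → Π [ i ,∞⟩ ⊨ᴹ ψ → Π ⊨ᴹ ◇ ψ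
⊨-◇ ψ Π i s = i , s , λ _ _ ¬p → ¬p (inj₂ λ p → ¬p (inj₁ p))

⊨-nonempty : ∀ a π (Π : Assignment (suc k)) → Π ⊨ᴹ a at π → Π ⊨ᴹ nonempty π
⊨-nonempty a π Π p = go (∈-allFin a)
  where
  go : ∀ {as} → a ∈ˡ as → Π ⊨ᴹ foldr (λ a ψ → a at π ∨′ ψ) (marked π) as
  go (here refl) = inj₁ p
  go (there q)   = inj₂ (go q)

nonempty-⊨ : ∀ {π} {Π : Assignment (suc k)} → Π ⊨ᴹ nonempty π → ∃[ a ] Π ⊨ᴹ a at π
nonempty-⊨ {π = π} {Π} = go (allFin _)
  where
  go : ∀ as → Π ⊨ᴹ foldr (λ a ψ → a at π ∨′ ψ) (marked π) as → ∃[ a ] Π ⊨ᴹ a at π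
  go []       p        = zero , p
  go (a ∷ as) (inj₁ p) = a , p
  go (a ∷ as) (inj₂ p) = go as p

-- Evaluating the separating sentence on trees

from-position : ℕ → Valuation k → Valuation k
from-position g σ π = suffix g (σ π)

module _ {k : ℕ} {s : Subset (suc k)} where

  ≡⊤⇒marked : s ≡ ⊤ → zero ∈ s
  ≡⊤⇒marked refl = ∈⊤

  ≡⊥⇒unmarked : s ≡ ⊥ → ¬ (zero ∈ s)
  ≡⊥⇒unmarked refl = ∉⊥

bounds-sound : ∀ {z x p} (σ : Valuation (suc k)) → ⟦ σ ⟧ [ p ,∞⟩ ⊨ᴹ bounds z x →
  zero ∈ σ z p × (∀ i → ¬ (zero ∈ σ z (p + suc i))) × Vanishes (p + 2) (σ x)
bounds-sound {k} {z} {x} {p} σ s = mark , last , empty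
  where
  Π₁ = ⟦ σ ⟧ [ p ,∞⟩ [ 1 ,∞⟩
  Π₂ = Π₁ [ 1 ,∞⟩
  mark : zero ∈ σ z p
  mark = subst (λ q → zero ∈ σ z q) (+-identityʳ p)
    -- Membership in a letter is decidable, which removes the double negation left by De Morgan.
    (decidable-stable (zero ∈? _) λ ¬m → s (inj₁ λ { (MaybeAny.just m) → ¬m m }))
  last : ∀ i → ¬ (zero ∈ σ z (p + suc i))
  last i m = s (inj₂ (inj₁ (⊨-◇ (marked z) Π₁ i (MaybeAny.just
    (subst (λ q → zero ∈ σ z (p + suc q)) (sym (+-identityʳ i)) m)))))
  shift : ∀ i → p + 2 + i ≡ p + suc (suc (i + 0))
  shift i = trans (+-assoc p 2 i) (cong (λ q → p + suc (suc q)) (sym (+-identityʳ i)))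
  empty : Vanishes (p + 2) (σ x)
  empty i = Empty-unique λ (a , m) → s (inj₂ (inj₂ (⊨-◇ (nonempty x) Π₂ i
    (⊨-nonempty a x (Π₂ [ i ,∞⟩) (MaybeAny.just (subst (λ q → a ∈ σ x q) (shift i) m))))))

bounds-complete : ∀ {z x p} (σ : Valuation (suc k)) →
  zero ∈ σ z p → (∀ i → ¬ (zero ∈ σ z (p + suc i))) → Vanishes (p + 2) (σ x) →
  ⟦ σ ⟧ [ p ,∞⟩ ⊨ᴹ bounds z x
bounds-complete {z = z} {x} {p} σ m last empty = λ where
  (inj₁ ¬m) → ¬m (MaybeAny.just (subst (λ q → zero ∈ σ z q) (sym (+-identityʳ p)) m))
  (inj₂ (inj₁ (i , MaybeAny.just m′ , _))) → last (i + 0) m′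
  (inj₂ (inj₂ (i , s , _))) → let a , m′ = nonempty-⊨ {π = x} s in
    ∉⊥ (subst (a ∈_) (trans (cong (σ x) (sym (+-assoc p 2 (i + 0)))) (empty (i + 0)))
      (MaybeAny.drop-just m′))

-- Locates a subtree inside T: the traces of its own leaves are seen from g on, and all other traces
-- are silent throughout the window. The evaluation can thus descend the tree while T stays fixed.
record Window (T : TraceSet k) (g : ℕ) (t : Tree) : Set where
  field
    realised   : (e : Leaf t) → Σ[ u ∈ Trace k ] (u ∈ᵀ T × suffix g u ≗ trace e)
    exhaustive : ∀ {u} → u ∈ᵀ T →
      (Σ[ e ∈ Leaf t ] suffix g u ≗ trace e) ⊎ (∀ i → i < size t → u (g + i) ≡ ⊥)

open Window

suffix-splice : ∀ g (u : Trace k) L {v x} → suffix g u ≗ x ∷ᵗ splice L 𝟘 v →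
  suffix (g + suc L) u ≗ v
suffix-splice g u L {v} p i =
  trans (cong u (+-assoc g (suc L) i)) (trans (p (suc (L + i))) (splice-≥ L 𝟘 v i))

∷ᵗ-cong : ∀ {x} {u v : Trace k} → u ≗ v → x ∷ᵗ u ≗ x ∷ᵗ v
∷ᵗ-cong p zero    = refl
∷ᵗ-cong p (suc i) = p i

≗-trans : {u v w : Trace k} → u ≗ v → v ≗ w → u ≗ w
≗-trans p q i = trans (p i) (q i)

Window-child : ∀ {T : TraceSet k} {g zs} xs {t ys} → zs ≡ xs ++ t ∷ ys →
  Window T g (node zs) → Window T (g + suc (sizes xs)) t
Window-child {T = T} {g} xs {t} {ys} refl w .realised e =
  let u , u∈T , eq = w .realised (below (++⁺ʳ xs (first e))) in
  u , u∈T , suffix-splice g u (sizes xs) (≗-trans eq (∷ᵗ-cong (traces-++⁺ʳ xs (first e))))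
Window-child {T = T} {g} xs {t} {ys} refl w .exhaustive {u} u∈T with w .exhaustive u∈T
... | inj₂ empty = inj₂ λ i i<t → trans (cong u (+-assoc g (suc (sizes xs)) i))
  (empty (suc (sizes xs + i)) (s≤s (≤-trans (+-monoʳ-< (sizes xs) (≤-trans i<t (m≤m+n _ _)))
    (≤-reflexive (sym (sizes-++ xs (t ∷ ys)))))))
... | inj₁ (below e , eq) with split xs e
...   | left e₁          = inj₂ λ i _ → trans (cong u (+-assoc g (suc (sizes xs)) i))
  (trans (eq (suc (sizes xs + i))) (trans (traces-++⁺ˡ e₁ (sizes xs + i)) (traces-vanishes e₁ i)))
...   | right (first e₂) = inj₁ (e₂ ,
  suffix-splice g u (sizes xs) (≗-trans eq (∷ᵗ-cong (traces-++⁺ʳ xs (first e₂)))))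
...   | right (later e₂) = inj₂ λ i i<t →
  trans (suffix-splice g u (sizes xs) (≗-trans eq (∷ᵗ-cong (traces-++⁺ʳ xs (later e₂)))) i)
    (splice-< 𝟘 (traces e₂) i<t)

module _ {k g L : ℕ} (j : ℕ) (σ : Valuation (suc k)) {v : Trace (suc k)}
         (p : suffix g (σ j) ≗ ⊤ ∷ᵗ splice L 𝟘 v) (v-head : v 0 ≡ ⊤) where

  private
    unmarked : ∀ {i} → i < L → ¬ (zero ∈ σ j (g + suc (i + 0)))
    unmarked {i} i<L = ≡⊥⇒unmarked
      (trans (p (suc (i + 0))) (splice-< 𝟘 v (≤-trans (≤-reflexive (cong suc (+-identityʳ i))) i<L)))

    marked-L : zero ∈ σ j (g + suc (L + 0))
    marked-L = ≡⊤⇒marked (trans (p (suc (L + 0))) (trans (splice-≥ L 𝟘 v 0) v-head))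

    child : ⟦ from-position g σ ⟧ [ 1 ,∞⟩ [ L ,∞⟩ ≋ ⟦ from-position (g + suc L) σ ⟧
    child π i = cong (σ π) (sym (+-assoc g (suc L) i))

  -- Variable j is marked at the node and next at the start of the chosen child, L + 1 positions
  -- later. The until can stop only there, and it negates `alternates j`, so truth flips from child
  -- to parent.
  alternates-suc⁺ : ¬ (⟦ from-position (g + suc L) σ ⟧ ⊨ᴹ alternates j) →
    ⟦ from-position g σ ⟧ ⊨ᴹ alternates (suc j)
  alternates-suc⁺ ¬s = inj₂ (L ,
    (λ { (inj₁ ¬m) → ¬m (MaybeAny.just marked-L)
       ; (inj₂ s) → ¬s (⊨-resp-≋ (alternates j) child s) }) ,
    λ { i i<L (MaybeAny.just m) → unmarked i<L m })

  alternates-suc⁻ : ⟦ from-position (g + suc L) σ ⟧ ⊨ᴹ alternates j →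
    ¬ (⟦ from-position g σ ⟧ ⊨ᴹ alternates (suc j))
  alternates-suc⁻ s (inj₁ ¬m) = ¬m (MaybeAny.just (≡⊤⇒marked (p 0)))
  alternates-suc⁻ s (inj₂ (i , s′ , before)) with <-cmp i L
  ... | tri< i<L _ _  = s′ (inj₁ λ { (MaybeAny.just m) → unmarked i<L m })
  ... | tri≈ _ refl _ = s′ (inj₂ (⊨-resp-≋ (alternates j) (≗ⱽ-sym child) s))
  ... | tri> _ _ L<i  = before L L<i (MaybeAny.just marked-L)

mutual
  leafᴬ : ∀ M j → Leaf (treeᴬ M j)
  leafᴬ M zero    = here
  leafᴬ M (suc j) = below (first (leafᴮ M j))

  leafᴮ : ∀ M j → Leaf (treeᴮ M j)
  leafᴮ M zero    = here
  leafᴮ M (suc j) = below (++⁺ʳ (replicate M (treeᴮ M j)) (first (leafᴬ M j)))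

Extends-refl : ∀ {T : TraceSet k} {Π} → Extends T 0 Π Π
Extends-refl = (λ _ _ _ → refl) , λ _ ()

-- A condition for the bottom of the recursion: there `alternates zero` reads the label off variable
-- 0, which for larger j is still to be bound.
Inside : ℕ → ℕ → Assignment k → Tree → Set
Inside j g Π t = j ≡ 0 → Σ[ e ∈ Leaf t ] suffix g (valuation Π 0) ≗ trace e

Inside-↦ : ∀ {j g} {Π : Assignment k} {u t} (e : Leaf t) → suffix g u ≗ trace e →
  Inside j g (Π [ j ↦ u ]) t
Inside-↦ e eq refl = e , eq

mutual
  -- In continuation form, ψ is any matrix implied by `alternates j` at the node. A leaf outside the
  -- node makes the formula true at once; a leaf inside selects a child `treeᴮ M j`, where the
  -- formula must fail.
  treeᴬ-∀∃ : ∀ M j {T : TraceSet (suc k)} g Π {ψ} →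
    Window T g (treeᴬ M j) → Inside j g Π (treeᴬ M j) →
    (∀ Π′ → Extends T j Π Π′ → ⟦ from-position g (valuation Π′) ⟧ ⊨ᴹ alternates j → Π′ ⊨ᴹ ψ) →
    T , Π ⊨ᶠ ∀∃ j ψ
  treeᴬ-∀∃ M zero {T} g Π w inside h with here , eq ← inside refl =
    h Π (Extends-refl {T = T} {Π}) (MaybeAny.just (≡⊤⇒marked (eq 1)))
  treeᴬ-∀∃ M (suc j) {T} g Π w _ h u u∈T with w .exhaustive u∈T
  ... | inj₂ empty = ∃∀-valid j u∈T λ Π′ ext → h Π′ (Extends-suc {T = T} {Π = Π} {Π′} u∈T ext)
    (inj₁ λ { (MaybeAny.just m) → ≡⊥⇒unmarked
      (trans (Extends-↦ {T = T} {Π = Π} {Π′} ext (g + 0)) (empty 0 z<s)) m })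
  ... | inj₁ (below e , eq) with p₁ , p₂ , e₀ , eq₁ , eq₂ ← locate (suc (M + M)) e =
    treeᴮ-∃∀ M j _ (Π [ j ↦ u ])
      (Window-child (replicate p₁ B) (trans (cong (λ p → replicate p B) eq₁) (replicate-+ p₁)) w)
      (Inside-↦ {Π = Π} e₀ (suffix-splice g u L (≗-trans eq (∷ᵗ-cong eq₂))))
      λ Π′ ext → h Π′ (Extends-suc {T = T} {Π = Π} {Π′} u∈T ext)
        ∘ alternates-suc⁺ {g = g} {L} j (valuation Π′) {trace e₀}
            (λ i → trans (Extends-↦ {T = T} {Π = Π} {Π′} ext (g + i))
              (trans (eq i) (∷ᵗ-cong eq₂ i)))
            (trace-head e₀)
    where
    B = treeᴮ M j
    L = sizes (replicate p₁ B)

  -- The existential choice is a leaf of the odd child `treeᴬ M j`; the formula holds there and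
  -- hence fails at the node.
  treeᴮ-∃∀ : ∀ M j {T : TraceSet (suc k)} g Π {ψ} →
    Window T g (treeᴮ M j) → Inside j g Π (treeᴮ M j) →
    (∀ Π′ → Extends T j Π Π′ → ¬ (⟦ from-position g (valuation Π′) ⟧ ⊨ᴹ alternates j) → Π′ ⊨ᴹ ψ) →
    T , Π ⊨ᶠ ∃∀ j ψ
  treeᴮ-∃∀ M zero {T} g Π w inside h with here , eq ← inside refl =
    h Π (Extends-refl {T = T} {Π}) λ { (MaybeAny.just m) → ≡⊥⇒unmarked (eq 1) m }
  treeᴮ-∃∀ M (suc j) {T} g Π w _ h
    with u , u∈T , eq ← w .realised (leafᴮ M (suc j)) =
    u , u∈T , treeᴬ-∀∃ M j _ (Π [ j ↦ u ])
      (Window-child Bs refl w)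
      (Inside-↦ {Π = Π} e₀ (suffix-splice g u L (≗-trans eq eq₂)))
      λ Π′ ext → h Π′ (Extends-suc {T = T} {Π = Π} {Π′} u∈T ext)
        ∘ alternates-suc⁻ {g = g} {L} j (valuation Π′) {trace e₀}
            (λ i → trans (Extends-↦ {T = T} {Π = Π} {Π′} ext (g + i)) (trans (eq i) (eq₂ i)))
            (trace-head e₀)
    where
    Bs = replicate M (treeᴮ M j)
    L  = sizes Bs
    e₀ = leafᴬ M j
    eq₂ : trace (leafᴮ M (suc j)) ≗ ⊤ ∷ᵗ splice L 𝟘 (trace e₀)
    eq₂ = ∷ᵗ-cong (traces-++⁺ʳ Bs (first e₀))

-- Boundedness of models, and separation

separating-bounds : ∀ n {T : TraceSet (suc k)} → T ⊨ separating n →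
  ∃[ p ] (∀ t → t ∈ᵀ T → Vanishes p t)
separating-bounds n {T} (z , z∈T , s) =
  let p , m , last , _ = lastMark z z∈T in p + 2 , λ t t∈T → vanish {t = t} m last (lastMark t t∈T)
  where
  LastMark : Trace (suc _) → Set
  LastMark t = ∃[ p ] (zero ∈ z p × (∀ i → ¬ (zero ∈ z (p + suc i))) × Vanishes (p + 2) t)
  lastMark : ∀ t → t ∈ᵀ T → LastMark t
  lastMark t t∈T
    with Π′ , ext , s′ ← ∃∀-witness n t∈T (s t t∈T)
    with p , b , _ ← ⊨-resp-≋ (body n) {Π′} {⟦ valuation Π′ ⟧} (λ _ _ → refl) s′
    with m , last , empty ← bounds-sound {z = suc n} {n} {p} (valuation Π′) b =
    p , subst (zero ∈_) (z≗ p) m , (λ i m → last i (subst (zero ∈_) (sym (z≗ (p + suc i))) m)) ,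
    λ i → trans (sym (Extends-↦ {T = T} {Π = Π∅ [ suc n ↦ z ]} {Π′} ext (p + 2 + i))) (empty i)
    where
    z≗ : valuation Π′ (suc n) ≗ z
    z≗ = Extends-↦ {T = T} {Π = Π∅} {Π′} (Extends-suc {T = T} {Π = Π∅ [ suc n ↦ z ]} {Π′} t∈T ext)
  -- Each t yields its own last mark of z. Since z has only one, the bound obtained from z itself
  -- works for every t.
  unique : ∀ {p q} → zero ∈ z p → (∀ i → ¬ (zero ∈ z (q + suc i))) → p ≤ q
  unique {p} {q} m last = ≮⇒≥ λ q<p → let i , eq = m≤n⇒∃[o]m+o≡n q<p in
    last i (subst (λ r → zero ∈ z r) (sym (trans (+-suc q i) eq)) m)
  vanish : ∀ {p t} → zero ∈ z p → (∀ i → ¬ (zero ∈ z (p + suc i))) → LastMark t → Vanishes (p + 2) t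
  vanish m last (q , m′ , last′ , empty)
    with refl ← ≤-antisym (unique m last′) (unique m′ last) = empty

-- The root marks position 0 on every trace. The extra leaf supplies a trace `z` whose last mark
-- lies beyond the window of t; its label is false so as not to count as a mark.
forest : Tree → List Tree
forest t = [ node (t ∷ leaf false ∷ []) ]

Window-root : ∀ {t} → Window {k} (forestTraces [ t ]) 0 t
Window-root .realised e = traces (first {xs = []} e) , (first e , λ _ → refl) , λ _ → refl
Window-root .exhaustive (first e , eq) = inj₁ (e , eq)

treeᴬ-⊨-separating : ∀ M n → forestTraces (forest (treeᴬ M (suc n))) ⊨ separating {k} n
treeᴬ-⊨-separating {k} M n = z , z∈T ,
  treeᴬ-∀∃ M (suc n) 1 (Π∅ [ suc n ↦ z ]) (Window-child [] refl Window-root) (λ ())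
    λ Π′ ext s → ⊨-resp-≋ (body n) {⟦ valuation Π′ ⟧} {Π′} (λ _ _ → refl)
      (body-holds (valuation Π′) (Extends-z {Π′} ext) (proj₂ ext n ≤-refl) s)
  where
  A = treeᴬ M (suc n)
  T = forestTraces (forest A)
  end : Leaves (forest A)
  end = first (below (later (first here)))
  z : Trace (suc k)
  z = traces end
  z∈T : z ∈ᵀ T
  z∈T = end , λ _ → refl
  Extends-z : ∀ {Π′} → Extends T (suc n) (Π∅ [ suc n ↦ z ]) Π′ → valuation Π′ (suc n) ≗ z
  Extends-z {Π′} = Extends-↦ {T = T} {Π = Π∅} {Π′}
  body-holds : ∀ σ → σ (suc n) ≗ z → σ n ∈ᵀ T →
    ⟦ from-position 1 σ ⟧ ⊨ᴹ alternates (suc n) → ⟦ σ ⟧ ⊨ᴹ body n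
  -- The extra leaf starts after the root's mark and the window of A. Strictly between the root and
  -- that leaf, z is unmarked.
  body-holds σ σ≗z (e , σ≗e) s = suc (size A) , bounds-complete {z = suc n} {n} {suc (size A)} σ
    (≡⊤⇒marked (trans (σ≗z _) (trans (cong (z ∘ suc) (sym (+-identityʳ (size A)))) (z-last 0))))
    (λ i → ≡⊥⇒unmarked (trans (σ≗z _) (trans (z-last (suc i)) (tail i))))
    (λ i → trans (σ≗e _) (trans (cong (traces e) (cong (_+ i) size≡)) (traces-vanishes e i)))
    , λ where
      zero    _         → inj₂ s
      (suc i) (s≤s i<A) → inj₁ λ { (MaybeAny.just m) → ≡⊥⇒unmarked (trans (σ≗z _)
        (trans (cong z (+-identityʳ (suc i))) (splice-< 𝟘 _ i<A))) m }
    where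
    last : Trace (suc k)
    last = ⊤ ∷ᵗ ⊥ ∷ᵗ 𝟘
    tail : ∀ i → last (suc i) ≡ ⊥
    tail zero    = refl
    tail (suc i) = refl
    z-last : ∀ i → z (suc (size A) + i) ≡ last i
    z-last i = splice-≥ (size A) 𝟘 last i
    size≡ : suc (size A) + 2 ≡ sizes (forest A)
    size≡ = sym (+-identityʳ (suc (size A + 2)))

-- Every leaf is marked at the root and again later. Hence the until cannot be fulfilled at position
-- 0, and its left argument there forces `alternates (suc n)` where the tree starts.
treeᴮ-⊭-separating : ∀ M n → ¬ (forestTraces (forest (treeᴮ M (suc n))) ⊨ separating {k} n)
treeᴮ-⊭-separating {k} M n (z , (e , eq) , s) = ∀∃-¬-∃∀ (suc n) s
  (treeᴮ-∃∀ M (suc n) 1 (Π∅ [ suc n ↦ z ]) (Window-child [] refl Window-root) (λ ())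
    λ Π′ ext ¬s b → body-fails (valuation Π′) (Extends-z {Π′} ext) ¬s
      (⊨-resp-≋ (body n) {Π′} {⟦ valuation Π′ ⟧} (λ _ _ → refl) b))
  where
  B = treeᴮ M (suc n)
  T = forestTraces (forest B)
  Extends-z : ∀ {Π′} → Extends T (suc n) (Π∅ [ suc n ↦ z ]) Π′ → valuation Π′ (suc n) ≗ z
  Extends-z {Π′} = Extends-↦ {T = T} {Π = Π∅} {Π′}
  head : (e : Leaves (forest B)) → traces {k = suc k} e 0 ≡ ⊤
  head (first e) = trace-head e
  later-mark : (e : Leaves (forest B)) → ∃[ i ] traces {k = suc k} e (suc i) ≡ ⊤
  later-mark (first (below (first e)))         = 0 , trace-head e
  later-mark (first (below (later (first e)))) =
    size B + 0 , trans (splice-≥ (size B) 𝟘 (trace e) 0) (trace-head e)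
  body-fails : ∀ σ → σ (suc n) ≗ z → ¬ (⟦ from-position 1 σ ⟧ ⊨ᴹ alternates (suc n)) →
    ¬ (⟦ σ ⟧ ⊨ᴹ body n)
  body-fails σ σ≗z ¬s (zero , b , _)
    with _ , last , _ ← bounds-sound {z = suc n} {n} {0} σ b | i , eq′ ← later-mark e =
    last i (≡⊤⇒marked (trans (σ≗z _) (trans (eq _) eq′)))
  body-fails σ σ≗z ¬s (suc p , _ , f) with f 0 z<s
  ... | inj₁ ¬m = ¬m (MaybeAny.just (≡⊤⇒marked (trans (σ≗z _) (trans (eq _) (head e)))))
  ... | inj₂ s  = ¬s s

separating-≄ : ∀ n (φ : Formula (suc k)) → IsΣ (suc n) φ → ¬ (separating n ≃ φ)
separating-≄ {k} n φ h eq = treeᴮ-⊭-separating M n (from (eq _)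
  (Σ-transfer d (suc n) m win h ≤-refl ≤-refl Π∅ Π∅
    (empty (sizes (forest A))) (empty (sizes (forest B))) (to (eq _) (treeᴬ-⊨-separating M n))))
  where
  d = depthᶠ φ
  m = quantifiers φ
  -- The trees are chosen after φ, large enough for its number of quantifiers and its X-depth.
  M = threshold {suc k} d m
  A = treeᴬ M (suc n)
  B = treeᴮ M (suc n)
  win : Win {suc k} d (suc n) m (forest A , 𝟘ⱽ) (forest B , 𝟘ⱽ)
  win = Win-node-𝟘 d (suc n) m (Win-between d (suc n) m {xs = []} {[]} refl refl
    (Win-refl d (suc n) m) (Win-trees d M (suc n) m ≤-refl) (Win-refl d (suc n) m))
  empty : ∀ L → 𝟘ⱽ ≗ⱽ spliceⱽ {suc k} L 𝟘ⱽ 𝟘ⱽ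
  empty L π i = sym (splice-𝟘 L i)

theorem4 : (k : ℕ) → .{{_ : NonZero k}} →
    (n : ℕ) → n > 0 →
    Σ[ φ ∈ Formula k ]
    ( IsΣSentence (suc n) φ
    × ((φ′ : Formula k) → IsΣSentence n φ′ → ¬ (φ ≃ φ′))
    × ((T : TraceSet k) → T ⊨ φ →
    Finite T × ((t : Trace k) → t ∈ᵀ T → EventuallyEmpty t)) )
theorem4 (suc k) (suc n) _ =
    separating n
  , separating-IsΣSentence n
  , (λ φ′ (h , _) → separating-≄ n φ′ h)
  , λ T s → let p , h = separating-bounds n s in
      vanishing⇒Finite {T = T} p h , λ t t∈T → vanishes⇒EventuallyEmpty {t = t} (h t t∈T)
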